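{- Let $a$ be a nonzero integer, let $(L_n)_{n\ge0}$ be the Lucas sequence $L(a,1)$, let $p\ge3$ be a prime with $\alpha_L(p)>2$, let $D=a^2+4$, and let $\lambda_1=\frac{a+\sqrt D}{2}$, $\lambda_2=\frac{a-\sqrt D}{2}$. Suppose that $p^2\mid D$, or that $(\lambda_2/\lambda_1)^l-1$ is not divisible by $\pi^2$, where $l$ is the order of $\lambda_2/\lambda_1$ modulo $\pi$. Then $$\overline{\left\{\frac{L_{n+\alpha_L(p)}}{L_n}\right\}_{n}}\ \cup\ \overline{\left\{\frac{L_{n+\alpha_L(p)-2}}{L_n}\right\}_{n}}=\mathbf{Q}_p.$$ In particular, if $(F_n)$ is the Fibonacci sequence and $p\ge3$ is not a Wall–Sun–Sun prime, then $$\overline{\left\{\frac{F_{n+\alpha_F(p)}}{F_n}\right\}_{n}}\ \cup\ \overline{\left\{\frac{F_{n+\alpha_F(p)-2}}{F_n}\right\}_{n}}=\mathbf{Q}_p.$$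
   Context: The Lucas sequence $L(a,b)$ is defined by $L_0=0$, $L_1=1$, $L_n=aL_{n-1}+bL_{n-2}$ ($n\ge2$); the Fibonacci sequence is $L(1,1)$. The sets in the claim range over $n\ge0$ with $L_n\ne0$ (resp. $F_n\neq 0$), and the bars denote closure in $\mathbf{Q}_p$. The rank of appearance $\alpha_L(p)$ is the least $n\ge1$ with $p\mid L_n$. A prime $p$ is a Wall–Sun–Sun prime if $p^2\mid F_{\alpha_F(p)}$. Here $\pi$ is a uniformizer of $\mathbf{Q}_p(\sqrt D)$ (with $\pi=p$ when $\mathbf{Q}_p(\sqrt D)=\mathbf{Q}_p$ or is unramified over $\mathbf{Q}_p$; $|\pi|_p=p^{ -1/2}$ when ramified); divisibility and congruences are in the ring of integers of $\mathbf{Q}_p(\sqrt D)$, and the order of a unit $u$ modulo $\pi$ is the least $l\ge1$ with $u^l\equiv 1\pmod\pi$. -}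

module Defs where

open import Algebra.Bundles using (CommutativeRing)
open import Data.Empty using (⊥-elim)
open import Data.Integer.Base as ℤ using (ℤ; +_; 0ℤ; 1ℤ)
open import Data.Integer.Divisibility using () renaming (_∣_ to _∣ℤ_)
import Data.Integer.Divisibility.Signed as ℤₛ
import Data.Integer.Properties as ℤ
open import Data.List.Base using (List; []; _∷_)
open import Data.List.Relation.Unary.All using (All)
open import Data.Nat.Base as ℕ using (ℕ; zero; suc; _≤_; _<_; _⊔_; _∸_)
open import Data.Nat.Coprimality as Coprime using (Coprime)
open import Data.Nat.Divisibility using (_∣_; _∤_; divides; _∣?_; ∣-trans; ∣1⇒≡1; m∣m*n; n∣m*n)
open import Data.Nat.Induction using (<-wellFounded)
open import Data.Nat.Primality using (Prime; euclidsLemma; prime⇒irreducible; prime⇒nonTrivial)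
import Data.Nat.Properties as ℕ
open import Data.Product.Base using (Σ; ∃; ∃₂; _×_; _,_)
open import Data.Rational.Base as ℚ using (ℚ; mkℚ; _+_; _*_; -_; _-_; 0ℚ; 1ℚ; ½; ↥_; ↧_; ↧ₙ_)
import Data.Rational.Properties as ℚ
open import Data.Rational.Solver using (module +-*-Solver)
import Data.Rational.Unnormalised.Base as ℚᵘ
import Data.Rational.Unnormalised.Properties as ℚᵘ
open import Data.Sum.Base using (inj₁; inj₂; [_,_]′)
open import Induction.WellFounded using (Acc; acc)
open import Level using (0ℓ)
open import Relation.Binary.PropositionalEquality
open import Relation.Nullary using (¬_; yes; no)
open import Relation.Unary using (Pred)
import Algebra.Properties.Semiring.Exp as Exp
import Algebra.Solver.Ring.NaturalCoefficients.Default as NatSolver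

lucas : ℤ → ℤ → ℕ → ℤ
lucas a b zero          = 0ℤ
lucas a b (suc zero)    = 1ℤ
lucas a b (suc (suc n)) = a ℤ.* lucas a b (suc n) ℤ.+ b ℤ.* lucas a b n

fibonacci : ℕ → ℤ
fibonacci = lucas 1ℤ 1ℤ

IsRankOfAppearance : (ℕ → ℤ) → ℕ → ℕ → Set
IsRankOfAppearance L p α =
  1 ≤ α × (+ p) ∣ℤ L α × (∀ n → 1 ≤ n → (+ p) ∣ℤ L n → α ≤ n)

IsWallSunSun : ℕ → Set
IsWallSunSun p =
  Prime p × ∃ λ α → IsRankOfAppearance fibonacci p α × (+ (p ℕ.^ 2)) ∣ℤ fibonacci α

fromℤ : ℤ → ℚ
fromℤ z = z ℚ./ 1

private
  toℚᵘ-fromℤ : ∀ z → ℚ.toℚᵘ (fromℤ z) ℚᵘ.≃ ℚᵘ.mkℚᵘ z 0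
  toℚᵘ-fromℤ z = ℚ.toℚᵘ-fromℚᵘ (ℚᵘ.mkℚᵘ z 0)

fromℤ-injective : ∀ {x y} → fromℤ x ≡ fromℤ y → x ≡ y
fromℤ-injective {x} {y} eq
  with ℚ.fromℚᵘ-injective {ℚᵘ.mkℚᵘ x 0} {ℚᵘ.mkℚᵘ y 0} eq
... | ℚᵘ.*≡* e = trans (sym (ℤ.*-identityʳ x)) (trans e (ℤ.*-identityʳ y))

fromℤ-homo-* : ∀ x y → fromℤ (x ℤ.* y) ≡ fromℤ x * fromℤ y
fromℤ-homo-* x y = ℚ.toℚᵘ-injective
  (ℚᵘ.≃-trans (toℚᵘ-fromℤ (x ℤ.* y))
  (ℚᵘ.≃-sym (ℚᵘ.≃-trans (ℚ.toℚᵘ-homo-* (fromℤ x) (fromℤ y))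
                        (ℚᵘ.*-cong (toℚᵘ-fromℤ x) (toℚᵘ-fromℤ y)))))

fromℤ-homo-+ : ∀ x y → fromℤ (x ℤ.+ y) ≡ fromℤ x + fromℤ y
fromℤ-homo-+ x y = ℚ.toℚᵘ-injective
  (ℚᵘ.≃-trans (toℚᵘ-fromℤ (x ℤ.+ y))
  (ℚᵘ.≃-sym (ℚᵘ.≃-trans (ℚ.toℚᵘ-homo-+ (fromℤ x) (fromℤ y))
            (ℚᵘ.≃-trans (ℚᵘ.+-cong (toℚᵘ-fromℤ x) (toℚᵘ-fromℤ y))
              (ℚᵘ.*≡* (cong (ℤ._* 1ℤ)
                (cong₂ ℤ._+_ (ℤ.*-identityʳ x) (ℤ.*-identityʳ y))))))))

*-fromℤ-↧ : ∀ q → q * fromℤ (↧ q) ≡ fromℤ (↥ q)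
*-fromℤ-↧ q@(mkℚ n d-1 _) = ℚ.toℚᵘ-injective
  (ℚᵘ.≃-trans (ℚ.toℚᵘ-homo-* q (fromℤ (↧ q)))
  (ℚᵘ.≃-trans (ℚᵘ.*-cong {ℚ.toℚᵘ q} ℚᵘ.≃-refl (toℚᵘ-fromℤ (↧ q)))
  (ℚᵘ.≃-trans (ℚᵘ.*≡* (trans (ℤ.*-identityʳ _)
                 (cong (n ℤ.*_) (cong +_ (sym (ℕ.*-identityʳ (suc d-1)))))))
  (ℚᵘ.≃-sym (toℚᵘ-fromℤ n)))))

ratio : (x y : ℤ) → y ≢ 0ℤ → ℚ
ratio x y y≢0 = ℚ._÷_ (fromℤ x) (fromℤ y)
  {{ℚ.≢-nonZero (λ eq → y≢0 (fromℤ-injective {y} {0ℤ} eq))}}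

module QuadraticAdjunction {c ℓ} (R : CommutativeRing c ℓ) (d : CommutativeRing.Carrier R) where
  private
    module R = CommutativeRing R
    open NatSolver R.commutativeSemiring

  -- R[X]/(X² − d), with (x , y) standing for x + y X.
  adjunction : CommutativeRing c ℓ
  adjunction = record
    { Carrier = R.Carrier × R.Carrier
    ; _≈_ = λ (x , y) (x′ , y′) → x R.≈ x′ × y R.≈ y′
    ; _+_ = λ (x , y) (x′ , y′) → x R.+ x′ , y R.+ y′
    ; _*_ = λ (x , y) (x′ , y′) → x R.* x′ R.+ d R.* (y R.* y′) , x R.* y′ R.+ y R.* x′
    ; -_ = λ (x , y) → R.- x , R.- y
    ; 0# = R.0# , R.0#
    ; 1# = R.1# , R.0#
    ; isCommutativeRing = record
      { isRing = record
        { +-isAbelianGroup = record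
          { isGroup = record
            { isMonoid = record
              { isSemigroup = record
                { isMagma = record
                  { isEquivalence = record
                    { refl = R.refl , R.refl
                    ; sym = λ (e , f) → R.sym e , R.sym f
                    ; trans = λ (e , f) (g , h) → R.trans e g , R.trans f h }
                  ; ∙-cong = λ (e , f) (g , h) → R.+-cong e g , R.+-cong f h }
                ; assoc = λ _ _ _ → R.+-assoc _ _ _ , R.+-assoc _ _ _ }
              ; identity = (λ _ → R.+-identityˡ _ , R.+-identityˡ _)
                         , (λ _ → R.+-identityʳ _ , R.+-identityʳ _) }
            ; inverse = (λ _ → R.-‿inverseˡ _ , R.-‿inverseˡ _)
                      , (λ _ → R.-‿inverseʳ _ , R.-‿inverseʳ _)
            ; ⁻¹-cong = λ (e , f) → R.-‿cong e , R.-‿cong f }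
          ; comm = λ _ _ → R.+-comm _ _ , R.+-comm _ _ }
        ; *-cong = λ (e , f) (g , h) →
            R.+-cong (R.*-cong e g) (R.*-cong R.refl (R.*-cong f h))
          , R.+-cong (R.*-cong e h) (R.*-cong f g)
        ; *-assoc = λ (x , y) (x′ , y′) (x″ , y″) →
            solve 7 (λ d x y x′ y′ x″ y″ →
                (x :* x′ :+ d :* (y :* y′)) :* x″ :+ d :* ((x :* y′ :+ y :* x′) :* y″)
             := x :* (x′ :* x″ :+ d :* (y′ :* y″)) :+ d :* (y :* (x′ :* y″ :+ y′ :* x″)))
              R.refl d x y x′ y′ x″ y″
          , solve 7 (λ d x y x′ y′ x″ y″ →
                (x :* x′ :+ d :* (y :* y′)) :* y″ :+ (x :* y′ :+ y :* x′) :* x″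
             := x :* (x′ :* y″ :+ y′ :* x″) :+ y :* (x′ :* x″ :+ d :* (y′ :* y″)))
              R.refl d x y x′ y′ x″ y″
        ; *-identity =
            (λ (x , y) →
                solve 3 (λ d x y → con 1 :* x :+ d :* (con 0 :* y) := x) R.refl d x y
              , solve 2 (λ x y → con 1 :* y :+ con 0 :* x := y) R.refl x y)
          , (λ (x , y) →
                solve 3 (λ d x y → x :* con 1 :+ d :* (y :* con 0) := x) R.refl d x y
              , solve 2 (λ x y → x :* con 0 :+ y :* con 1 := y) R.refl x y)
        ; distrib =
            (λ (x , y) (x′ , y′) (x″ , y″) →
                solve 7 (λ d x y x′ y′ x″ y″ →
                    x :* (x′ :+ x″) :+ d :* (y :* (y′ :+ y″))
                 := (x :* x′ :+ d :* (y :* y′)) :+ (x :* x″ :+ d :* (y :* y″)))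
                  R.refl d x y x′ y′ x″ y″
              , solve 6 (λ x y x′ y′ x″ y″ →
                    x :* (y′ :+ y″) :+ y :* (x′ :+ x″)
                 := (x :* y′ :+ y :* x′) :+ (x :* y″ :+ y :* x″))
                  R.refl x y x′ y′ x″ y″)
          , (λ (x , y) (x′ , y′) (x″ , y″) →
                solve 7 (λ d x y x′ y′ x″ y″ →
                    (x′ :+ x″) :* x :+ d :* ((y′ :+ y″) :* y)
                 := (x′ :* x :+ d :* (y′ :* y)) :+ (x″ :* x :+ d :* (y″ :* y)))
                  R.refl d x y x′ y′ x″ y″
              , solve 6 (λ x y x′ y′ x″ y″ →
                    (x′ :+ x″) :* y :+ (y′ :+ y″) :* x
                 := (x′ :* y :+ y′ :* x) :+ (x″ :* y :+ y″ :* x))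
                  R.refl x y x′ y′ x″ y″) }
      ; *-comm = λ (x , y) (x′ , y′) →
            solve 5 (λ d x y x′ y′ →
                x :* x′ :+ d :* (y :* y′) := x′ :* x :+ d :* (y′ :* y))
              R.refl d x y x′ y′
          , solve 4 (λ x y x′ y′ → x :* y′ :+ y :* x′ := x′ :* y :+ y′ :* x)
              R.refl x y x′ y′ } }

module Adic (p : ℕ) (p-prime : Prime p) where

  -- |q|ₚ ≤ p⁻ᵏ; numerator and denominator of q are in lowest terms.
  infix 4 ∣_∣≤p^-_
  record ∣_∣≤p^-_ (q : ℚ) (k : ℕ) : Set where
    constructor small
    field
      p^k∣↥ : (p ℕ.^ k) ∣ ℤ.∣ ↥ q ∣
      p∤↧   : p ∤ ↧ₙ q

  private
    p∤1 : p ∤ 1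
    p∤1 p∣1 = ℕ.nonTrivial⇒≢1 {{prime⇒nonTrivial p-prime}} (∣1⇒≡1 p∣1)

    p∤* : ∀ {m n} → p ∤ m → p ∤ n → p ∤ m ℕ.* n
    p∤* {m} {n} p∤m p∤n p∣mn = [ p∤m , p∤n ]′ (euclidsLemma m n p-prime p∣mn)

    p^k-coprime : ∀ k {d} → p ∤ d → Coprime (p ℕ.^ k) d
    p^k-coprime zero    p∤d (e∣1 , _) = ∣1⇒≡1 e∣1
    p^k-coprime (suc k) {d} p∤d {e} (e∣p^ , e∣d) =
      p^k-coprime k p∤d (Coprime.coprime-divisor coprime-e-p e∣p^ , e∣d)
      where
      coprime-e-p : Coprime e p
      coprime-e-p (f∣e , f∣p) with prime⇒irreducible p-prime f∣p
      ... | inj₁ f≡1 = f≡1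
      ... | inj₂ refl = ⊥-elim (p∤d (∣-trans f∣e e∣d))

  abstract
    -- |q|ₚ ≤ p⁻ᵏ iff q = pᵏ m / d with p ∤ d.
    small-intro : ∀ {q k} m d → p ∤ d →
                  q * fromℤ (+ d) ≡ fromℤ (m ℤ.* + (p ℕ.^ k)) → ∣ q ∣≤p^- k
    small-intro {q@(mkℚ n d-1 c)} {k} m d p∤d eq = small p^k∣n p∤↧
      where
      cross : n ℤ.* + d ≡ (m ℤ.* + (p ℕ.^ k)) ℤ.* ↧ q
      cross = fromℤ-injective (begin
        fromℤ (n ℤ.* + d)                                ≡⟨ fromℤ-homo-* n (+ d) ⟩
        fromℤ n * fromℤ (+ d)                            ≡⟨ cong (_* fromℤ (+ d)) (sym (*-fromℤ-↧ q)) ⟩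
        q * fromℤ (↧ q) * fromℤ (+ d)                    ≡⟨ ℚ.*-assoc q (fromℤ (↧ q)) (fromℤ (+ d)) ⟩
        q * (fromℤ (↧ q) * fromℤ (+ d))                  ≡⟨ cong (q *_) (ℚ.*-comm (fromℤ (↧ q)) (fromℤ (+ d))) ⟩
        q * (fromℤ (+ d) * fromℤ (↧ q))                  ≡⟨ sym (ℚ.*-assoc q (fromℤ (+ d)) (fromℤ (↧ q))) ⟩
        q * fromℤ (+ d) * fromℤ (↧ q)                    ≡⟨ cong (_* fromℤ (↧ q)) eq ⟩
        fromℤ (m ℤ.* + (p ℕ.^ k)) * fromℤ (↧ q)          ≡⟨ sym (fromℤ-homo-* (m ℤ.* + (p ℕ.^ k)) (↧ q)) ⟩
        fromℤ ((m ℤ.* + (p ℕ.^ k)) ℤ.* ↧ q)              ∎)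
        where open ≡-Reasoning
      abs : ℤ.∣ n ∣ ℕ.* d ≡ ℤ.∣ m ∣ ℕ.* p ℕ.^ k ℕ.* suc d-1
      abs = trans (sym (ℤ.abs-* n (+ d))) (trans (cong ℤ.∣_∣ cross)
              (trans (ℤ.abs-* (m ℤ.* + (p ℕ.^ k)) (↧ q))
                (cong (ℕ._* suc d-1) (ℤ.abs-* m (+ (p ℕ.^ k))))))
      p^k∣n : p ℕ.^ k ∣ ℤ.∣ n ∣
      p^k∣n = Coprime.coprime-divisor (p^k-coprime k p∤d)
        (subst (p ℕ.^ k ∣_) (trans (sym abs) (ℕ.*-comm ℤ.∣ n ∣ d))
          (∣-trans (n∣m*n ℤ.∣ m ∣) (m∣m*n (suc d-1))))
      p∤↧ : p ∤ suc d-1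
      p∤↧ p∣↧ = p∤d (∣-trans p∣↧ (Coprime.coprime-divisor
        (Coprime.sym (Coprime.recompute c))
        (divides (ℤ.∣ m ∣ ℕ.* p ℕ.^ k) abs)))

    small-elim : ∀ {q k} → ∣ q ∣≤p^- k →
                 ∃₂ λ m d → p ∤ d × q * fromℤ (+ d) ≡ fromℤ (m ℤ.* + (p ℕ.^ k))
    small-elim {q} {k} (small p^k∣n p∤↧) with ℤₛ.∣ᵤ⇒∣ {+ (p ℕ.^ k)} {↥ q} p^k∣n
    ... | ℤₛ.divides m eq = m , ↧ₙ q , p∤↧ , trans (*-fromℤ-↧ q) (cong fromℤ eq)

    small-0 : ∀ k → ∣ 0ℚ ∣≤p^- k
    small-0 k = small-intro 0ℤ 1 p∤1 refl

    small-diff : ∀ {x y k} → x ≡ y → ∣ x - y ∣≤p^- k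
    small-diff {x} {k = k} refl = subst (∣_∣≤p^- k) (sym (ℚ.+-inverseʳ x)) (small-0 k)

    small-+ : ∀ {x y k} → ∣ x ∣≤p^- k → ∣ y ∣≤p^- k → ∣ x + y ∣≤p^- k
    small-+ {x} {y} {k} sx sy =
      let m , d , p∤d , ex = small-elim sx
          n , e , p∤e , ey = small-elim sy
          P = + (p ℕ.^ k)
      in small-intro (m ℤ.* + e ℤ.+ n ℤ.* + d) (d ℕ.* e) (p∤* p∤d p∤e) (begin
        (x + y) * fromℤ (+ (d ℕ.* e))
          ≡⟨ cong (λ z → (x + y) * fromℤ z) (ℤ.pos-* d e) ⟩
        (x + y) * fromℤ (+ d ℤ.* + e)
          ≡⟨ cong ((x + y) *_) (fromℤ-homo-* (+ d) (+ e)) ⟩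
        (x + y) * (fromℤ (+ d) * fromℤ (+ e))
          ≡⟨ solve 4 (λ x y d e → (x :+ y) :* (d :* e) := x :* d :* e :+ y :* e :* d)
               refl x y (fromℤ (+ d)) (fromℤ (+ e)) ⟩
        x * fromℤ (+ d) * fromℤ (+ e) + y * fromℤ (+ e) * fromℤ (+ d)
          ≡⟨ cong₂ (λ s t → s * fromℤ (+ e) + t * fromℤ (+ d)) ex ey ⟩
        fromℤ (m ℤ.* P) * fromℤ (+ e) + fromℤ (n ℤ.* P) * fromℤ (+ d)
          ≡⟨ cong₂ (λ s t → s * fromℤ (+ e) + t * fromℤ (+ d)) (fromℤ-homo-* m P) (fromℤ-homo-* n P) ⟩
        fromℤ m * fromℤ P * fromℤ (+ e) + fromℤ n * fromℤ P * fromℤ (+ d)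
          ≡⟨ solve 5 (λ m n P d e → m :* P :* e :+ n :* P :* d := (m :* e :+ n :* d) :* P)
               refl (fromℤ m) (fromℤ n) (fromℤ P) (fromℤ (+ d)) (fromℤ (+ e)) ⟩
        (fromℤ m * fromℤ (+ e) + fromℤ n * fromℤ (+ d)) * fromℤ P
          ≡⟨ cong₂ (λ s t → (s + t) * fromℤ P)
               (sym (fromℤ-homo-* m (+ e))) (sym (fromℤ-homo-* n (+ d))) ⟩
        (fromℤ (m ℤ.* + e) + fromℤ (n ℤ.* + d)) * fromℤ P
          ≡⟨ cong (_* fromℤ P) (sym (fromℤ-homo-+ (m ℤ.* + e) (n ℤ.* + d))) ⟩
        fromℤ (m ℤ.* + e ℤ.+ n ℤ.* + d) * fromℤ P
          ≡⟨ sym (fromℤ-homo-* (m ℤ.* + e ℤ.+ n ℤ.* + d) P) ⟩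
        fromℤ ((m ℤ.* + e ℤ.+ n ℤ.* + d) ℤ.* P) ∎)
      where
      open ≡-Reasoning
      open +-*-Solver

    small-neg : ∀ {x k} → ∣ x ∣≤p^- k → ∣ - x ∣≤p^- k
    small-neg {mkℚ (+ zero)   _ _} (small n d) = small n d
    small-neg {mkℚ (+ suc _)  _ _} (small n d) = small n d
    small-neg {mkℚ ℤ.-[1+ _ ] _ _} (small n d) = small n d

    small-* : ∀ {x y j k} → ∣ x ∣≤p^- j → ∣ y ∣≤p^- k → ∣ x * y ∣≤p^- (j ℕ.+ k)
    small-* {x} {y} {j} {k} sx sy =
      let m , d , p∤d , ex = small-elim sx
          n , e , p∤e , ey = small-elim sy
          P = + (p ℕ.^ j)
          Q = + (p ℕ.^ k)
      in small-intro (m ℤ.* n) (d ℕ.* e) (p∤* p∤d p∤e) (begin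
        x * y * fromℤ (+ (d ℕ.* e))
          ≡⟨ cong (λ z → x * y * fromℤ z) (ℤ.pos-* d e) ⟩
        x * y * fromℤ (+ d ℤ.* + e)
          ≡⟨ cong ((x * y) *_) (fromℤ-homo-* (+ d) (+ e)) ⟩
        x * y * (fromℤ (+ d) * fromℤ (+ e))
          ≡⟨ solve 4 (λ x y d e → x :* y :* (d :* e) := (x :* d) :* (y :* e))
               refl x y (fromℤ (+ d)) (fromℤ (+ e)) ⟩
        (x * fromℤ (+ d)) * (y * fromℤ (+ e))
          ≡⟨ cong₂ _*_ (trans ex (fromℤ-homo-* m P)) (trans ey (fromℤ-homo-* n Q)) ⟩
        (fromℤ m * fromℤ P) * (fromℤ n * fromℤ Q)
          ≡⟨ solve 4 (λ m P n Q → (m :* P) :* (n :* Q) := (m :* n) :* (P :* Q))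
               refl (fromℤ m) (fromℤ P) (fromℤ n) (fromℤ Q) ⟩
        (fromℤ m * fromℤ n) * (fromℤ P * fromℤ Q)
          ≡⟨ cong₂ _*_ (sym (fromℤ-homo-* m n)) (sym (fromℤ-homo-* P Q)) ⟩
        fromℤ (m ℤ.* n) * fromℤ (P ℤ.* Q)
          ≡⟨ sym (fromℤ-homo-* (m ℤ.* n) (P ℤ.* Q)) ⟩
        fromℤ ((m ℤ.* n) ℤ.* (P ℤ.* Q))
          ≡⟨ cong (λ z → fromℤ ((m ℤ.* n) ℤ.* z))
               (trans (sym (ℤ.pos-* (p ℕ.^ j) (p ℕ.^ k))) (cong +_ (sym (ℕ.^-distribˡ-+-* p j k)))) ⟩
        fromℤ ((m ℤ.* n) ℤ.* + (p ℕ.^ (j ℕ.+ k))) ∎)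
      where
      open ≡-Reasoning
      open +-*-Solver

  private
    factor-p : ∀ n → Acc _<_ n → n ≢ 0 → ∃₂ λ e d → p ∤ d × n ≡ p ℕ.^ e ℕ.* d
    factor-p n (acc rs) n≢0 with p ∣? n
    ... | no p∤n = 0 , n , p∤n , sym (ℕ.+-identityʳ n)
    ... | yes (divides q n≡qp) =
      let instance
            _ = ℕ.≢-nonZero {q} (λ q≡0 → n≢0 (trans n≡qp (cong (ℕ._* p) q≡0)))
          q<n = subst (q <_) (sym n≡qp)
                  (ℕ.m<m*n q p (ℕ.nonTrivial⇒n>1 p {{prime⇒nonTrivial p-prime}}))
          e , d , p∤d , q≡ = factor-p q (rs q<n) (ℕ.≢-nonZero⁻¹ q)
      in suc e , d , p∤d , (begin
           n                       ≡⟨ n≡qp ⟩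
           q ℕ.* p                 ≡⟨ ℕ.*-comm q p ⟩
           p ℕ.* q                 ≡⟨ cong (p ℕ.*_) q≡ ⟩
           p ℕ.* (p ℕ.^ e ℕ.* d)   ≡⟨ sym (ℕ.*-assoc p (p ℕ.^ e) d) ⟩
           p ℕ.* p ℕ.^ e ℕ.* d     ∎)
      where open ≡-Reasoning

  -- |q|ₚ ≤ pᵉ
  Bounded : ℚ → ℕ → Set
  Bounded q e = ∀ {k x} → ∣ x ∣≤p^- (e ℕ.+ k) → ∣ q * x ∣≤p^- k

  abstract
    bounded : ∀ q → ∃ (Bounded q)
    bounded q =
      let e , d , p∤d , ↧≡ = factor-p (↧ₙ q) (<-wellFounded _) (λ ())
      in e , λ {k} {x} sx →
        let m , f , p∤f , ex = small-elim sx
            P = + (p ℕ.^ e)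
            Q = + (p ℕ.^ k)
        in small-intro (↥ q ℤ.* m) (d ℕ.* f) (p∤* p∤d p∤f) (begin
          q * x * fromℤ (+ (d ℕ.* f))
            ≡⟨ cong (λ z → q * x * fromℤ z) (ℤ.pos-* d f) ⟩
          q * x * fromℤ (+ d ℤ.* + f)
            ≡⟨ cong (q * x *_) (fromℤ-homo-* (+ d) (+ f)) ⟩
          q * x * (fromℤ (+ d) * fromℤ (+ f))
            ≡⟨ solve 4 (λ x y d e → x :* y :* (d :* e) := (x :* d) :* (y :* e))
                 refl q x (fromℤ (+ d)) (fromℤ (+ f)) ⟩
          q * fromℤ (+ d) * (x * fromℤ (+ f))
            ≡⟨ cong (q * fromℤ (+ d) *_) ex ⟩
          q * fromℤ (+ d) * fromℤ (m ℤ.* + (p ℕ.^ (e ℕ.+ k)))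
            ≡⟨ cong (λ z → q * fromℤ (+ d) * fromℤ (m ℤ.* z))
                 (trans (cong +_ (ℕ.^-distribˡ-+-* p e k)) (ℤ.pos-* (p ℕ.^ e) (p ℕ.^ k))) ⟩
          q * fromℤ (+ d) * fromℤ (m ℤ.* (P ℤ.* Q))
            ≡⟨ cong (q * fromℤ (+ d) *_) (trans (fromℤ-homo-* m (P ℤ.* Q))
                 (cong (fromℤ m *_) (fromℤ-homo-* P Q))) ⟩
          q * fromℤ (+ d) * (fromℤ m * (fromℤ P * fromℤ Q))
            ≡⟨ solve 5 (λ q d m P Q → q :* d :* (m :* (P :* Q)) := q :* (P :* d) :* (m :* Q))
                 refl q (fromℤ (+ d)) (fromℤ m) (fromℤ P) (fromℤ Q) ⟩
          q * (fromℤ P * fromℤ (+ d)) * (fromℤ m * fromℤ Q)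
            ≡⟨ cong (λ z → q * z * (fromℤ m * fromℤ Q))
                 (trans (sym (fromℤ-homo-* P (+ d)))
                   (cong fromℤ (trans (sym (ℤ.pos-* (p ℕ.^ e) d)) (cong +_ (sym ↧≡))))) ⟩
          q * fromℤ (↧ q) * (fromℤ m * fromℤ Q)
            ≡⟨ cong (_* (fromℤ m * fromℤ Q)) (*-fromℤ-↧ q) ⟩
          fromℤ (↥ q) * (fromℤ m * fromℤ Q)
            ≡⟨ sym (ℚ.*-assoc (fromℤ (↥ q)) (fromℤ m) (fromℤ Q)) ⟩
          fromℤ (↥ q) * fromℤ m * fromℤ Q
            ≡⟨ cong (_* fromℤ Q) (sym (fromℤ-homo-* (↥ q) m)) ⟩
          fromℤ (↥ q ℤ.* m) * fromℤ Q
            ≡⟨ sym (fromℤ-homo-* (↥ q ℤ.* m) Q) ⟩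
          fromℤ ((↥ q ℤ.* m) ℤ.* Q) ∎)
      where
      open ≡-Reasoning
      open +-*-Solver

    small-mono : ∀ {x j k} → j ≤ k → ∣ x ∣≤p^- k → ∣ x ∣≤p^- j
    small-mono {x} {j} {k} j≤k (small p^k∣n p∤↧) = small
      (∣-trans (divides (p ℕ.^ (k ∸ j)) (trans (cong (p ℕ.^_) (sym (ℕ.m∸n+n≡m j≤k)))
                 (ℕ.^-distribˡ-+-* p (k ∸ j) j))) p^k∣n) p∤↧

    diff-+ : ∀ {k} a b c d → ∣ a - b ∣≤p^- k → ∣ c - d ∣≤p^- k → ∣ (a + c) - (b + d) ∣≤p^- k
    diff-+ {k} a b c d h h′ = subst (∣_∣≤p^- k)
      (solve 4 (λ a b c d → (a :- b) :+ (c :- d) := (a :+ c) :- (b :+ d)) refl a b c d)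
      (small-+ {a - b} {c - d} h h′)
      where open +-*-Solver

    diff-neg : ∀ {k} a b → ∣ a - b ∣≤p^- k → ∣ - a - - b ∣≤p^- k
    diff-neg {k} a b h = subst (∣_∣≤p^- k)
      (solve 2 (λ a b → :- (a :- b) := (:- a) :- (:- b)) refl a b)
      (small-neg {a - b} h)
      where open +-*-Solver

    diff-sym : ∀ {k} a b → ∣ a - b ∣≤p^- k → ∣ b - a ∣≤p^- k
    diff-sym {k} a b h = subst (∣_∣≤p^- k)
      (solve 2 (λ a b → :- (a :- b) := b :- a) refl a b)
      (small-neg {a - b} h)
      where open +-*-Solver

    diff-trans : ∀ {k} a b c → ∣ a - b ∣≤p^- k → ∣ b - c ∣≤p^- k → ∣ a - c ∣≤p^- k
    diff-trans {k} a b c h h′ = subst (∣_∣≤p^- k)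
      (solve 3 (λ a b c → (a :- b) :+ (b :- c) := a :- c) refl a b c)
      (small-+ {a - b} {b - c} h h′)
      where open +-*-Solver

    diff-* : ∀ {k e f} a b c d → Bounded a e → Bounded d f →
             ∣ a - b ∣≤p^- (f ℕ.+ k) → ∣ c - d ∣≤p^- (e ℕ.+ k) → ∣ a * c - b * d ∣≤p^- k
    diff-* {k} a b c d ba bd h h′ = subst (∣_∣≤p^- k)
      (solve 4 (λ a b c d → a :* (c :- d) :+ d :* (a :- b) := a :* c :- b :* d) refl a b c d)
      (small-+ {a * (c - d)} {d * (a - b)} (ba {k} {c - d} h′) (bd {k} {a - b} h))
      where open +-*-Solver

    bounded-near : ∀ {e} a b → Bounded a e → ∣ b - a ∣≤p^- 0 → Bounded b e
    bounded-near {e} a b ba h {k} {y} sy = subst (∣_∣≤p^- k)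
      (solve 3 (λ a b y → a :* y :+ (b :- a) :* y := b :* y) refl a b y)
      (small-+ {a * y} {(b - a) * y} (ba {k} {y} sy)
        (small-* {b - a} {y} {0} {k} h (small-mono (ℕ.m≤n+m k e) sy)))
      where open +-*-Solver

  Cauchy : (ℕ → ℚ) → Set
  Cauchy x = ∀ k → ∃ λ N → ∀ m n → N ≤ m → N ≤ n → ∣ x m - x n ∣≤p^- k

  abstract
    eventually-bounded : ∀ x → Cauchy x → ∃₂ λ e N → ∀ n → N ≤ n → Bounded (x n) e
    eventually-bounded x cx =
      let N , h = cx 0
          e , b = bounded (x N)
      in e , N , λ n N≤n → bounded-near {e} (x N) (x n) b (h n N N≤n ℕ.≤-refl)

    const-cauchy : ∀ q → Cauchy (λ _ → q)
    const-cauchy q k = 0 , λ _ _ _ _ → small-diff {q} {q} refl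

    +-cauchy : ∀ x y → Cauchy x → Cauchy y → Cauchy (λ n → x n + y n)
    +-cauchy x y cx cy k =
      let M , hx = cx k
          N , hy = cy k
      in M ⊔ N , λ m n M≤m M≤n →
        diff-+ (x m) (x n) (y m) (y n)
          (hx m n (ℕ.m⊔n≤o⇒m≤o M N M≤m) (ℕ.m⊔n≤o⇒m≤o M N M≤n))
          (hy m n (ℕ.m⊔n≤o⇒n≤o M N M≤m) (ℕ.m⊔n≤o⇒n≤o M N M≤n))

    neg-cauchy : ∀ x → Cauchy x → Cauchy (λ n → - x n)
    neg-cauchy x cx k =
      let M , hx = cx k
      in M , λ m n M≤m M≤n → diff-neg (x m) (x n) (hx m n M≤m M≤n)

    *-cauchy : ∀ x y → Cauchy x → Cauchy y → Cauchy (λ n → x n * y n)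
    *-cauchy x y cx cy k =
      let e , M , bx = eventually-bounded x cx
          f , N , by = eventually-bounded y cy
          M′ , hx = cx (f ℕ.+ k)
          N′ , hy = cy (e ℕ.+ k)
          A = M ⊔ N
          B = M′ ⊔ N′
      in A ⊔ B , λ m n A≤m A≤n →
        diff-* {k} {e} {f} (x m) (x n) (y m) (y n)
          (bx m (ℕ.m⊔n≤o⇒m≤o M N (ℕ.m⊔n≤o⇒m≤o A B A≤m)))
          (by n (ℕ.m⊔n≤o⇒n≤o M N (ℕ.m⊔n≤o⇒m≤o A B A≤n)))
          (hx m n (ℕ.m⊔n≤o⇒m≤o M′ N′ (ℕ.m⊔n≤o⇒n≤o A B A≤m))
                  (ℕ.m⊔n≤o⇒m≤o M′ N′ (ℕ.m⊔n≤o⇒n≤o A B A≤n)))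
          (hy m n (ℕ.m⊔n≤o⇒n≤o M′ N′ (ℕ.m⊔n≤o⇒n≤o A B A≤m))
                  (ℕ.m⊔n≤o⇒n≤o M′ N′ (ℕ.m⊔n≤o⇒n≤o A B A≤n)))

  -- ℚₚ is the completion of ℚ for |·|ₚ: Cauchy sequences modulo null sequences.
  record ℚₚ : Set where
    constructor mkℚₚ
    field
      seq    : ℕ → ℚ
      cauchy : Cauchy seq
  open ℚₚ public

  fromℚ : ℚ → ℚₚ
  fromℚ q = mkℚₚ (λ _ → q) (const-cauchy q)

  infixl 6 _+ₚ_
  infixl 7 _*ₚ_
  infix  8 -ₚ_
  infix  4 _≈ₚ_ ∣_∣ₚ≤p^-_

  _+ₚ_ : ℚₚ → ℚₚ → ℚₚ
  x +ₚ y = mkℚₚ (λ n → seq x n + seq y n) (+-cauchy (seq x) (seq y) (cauchy x) (cauchy y))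

  -ₚ_ : ℚₚ → ℚₚ
  -ₚ x = mkℚₚ (λ n → - seq x n) (neg-cauchy (seq x) (cauchy x))

  _*ₚ_ : ℚₚ → ℚₚ → ℚₚ
  x *ₚ y = mkℚₚ (λ n → seq x n * seq y n) (*-cauchy (seq x) (seq y) (cauchy x) (cauchy y))

  record ∣_∣ₚ≤p^-_ (x : ℚₚ) (k : ℕ) : Set where
    constructor smallₚ
    field
      eventually : ∃ λ N → ∀ n → N ≤ n → ∣ seq x n ∣≤p^- k
  open ∣_∣ₚ≤p^-_ public

  record _≈ₚ_ (x y : ℚₚ) : Set where
    constructor mk≈ₚ
    field
      close : ∀ k → ∣ x +ₚ -ₚ y ∣ₚ≤p^- k
  open _≈ₚ_ public

  abstract
    pointwise : ∀ {x y} → (∀ n → seq x n ≡ seq y n) → x ≈ₚ y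
    pointwise {x} {y} eq = mk≈ₚ λ k → smallₚ (0 , λ n _ → small-diff {seq x n} {seq y n} (eq n))

    ≈ₚ-sym : ∀ {x y} → x ≈ₚ y → y ≈ₚ x
    ≈ₚ-sym {x} {y} e = mk≈ₚ λ k → smallₚ
      (let N , h = eventually (close e k)
       in N , λ n N≤n → diff-sym (seq x n) (seq y n) (h n N≤n))

    ≈ₚ-trans : ∀ {x y z} → x ≈ₚ y → y ≈ₚ z → x ≈ₚ z
    ≈ₚ-trans {x} {y} {z} e f = mk≈ₚ λ k → smallₚ
      (let M , g = eventually (close e k)
           N , h = eventually (close f k)
       in M ⊔ N , λ n M≤n → diff-trans (seq x n) (seq y n) (seq z n)
            (g n (ℕ.m⊔n≤o⇒m≤o M N M≤n)) (h n (ℕ.m⊔n≤o⇒n≤o M N M≤n)))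

    +ₚ-cong : ∀ {x x′ y y′} → x ≈ₚ x′ → y ≈ₚ y′ → x +ₚ y ≈ₚ x′ +ₚ y′
    +ₚ-cong {x} {x′} {y} {y′} e f = mk≈ₚ λ k → smallₚ
      (let M , g = eventually (close e k)
           N , h = eventually (close f k)
       in M ⊔ N , λ n M≤n → diff-+ (seq x n) (seq x′ n) (seq y n) (seq y′ n)
            (g n (ℕ.m⊔n≤o⇒m≤o M N M≤n)) (h n (ℕ.m⊔n≤o⇒n≤o M N M≤n)))

    -ₚ-cong : ∀ {x y} → x ≈ₚ y → -ₚ x ≈ₚ -ₚ y
    -ₚ-cong {x} {y} e = mk≈ₚ λ k → smallₚ
      (let N , h = eventually (close e k)
       in N , λ n N≤n → diff-neg (seq x n) (seq y n) (h n N≤n))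

    *ₚ-cong : ∀ {x x′ y y′} → x ≈ₚ x′ → y ≈ₚ y′ → x *ₚ y ≈ₚ x′ *ₚ y′
    *ₚ-cong {x} {x′} {y} {y′} e f = mk≈ₚ λ k → smallₚ
      (let i , M , bx = eventually-bounded (seq x) (cauchy x)
           j , N , by = eventually-bounded (seq y′) (cauchy y′)
           M′ , hx = eventually (close e (j ℕ.+ k))
           N′ , hy = eventually (close f (i ℕ.+ k))
           A = M ⊔ N
           B = M′ ⊔ N′
       in A ⊔ B , λ n A≤n → diff-* {k} {i} {j} (seq x n) (seq x′ n) (seq y n) (seq y′ n)
            (bx n (ℕ.m⊔n≤o⇒m≤o M N (ℕ.m⊔n≤o⇒m≤o A B A≤n)))
            (by n (ℕ.m⊔n≤o⇒n≤o M N (ℕ.m⊔n≤o⇒m≤o A B A≤n)))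
            (hx n (ℕ.m⊔n≤o⇒m≤o M′ N′ (ℕ.m⊔n≤o⇒n≤o A B A≤n)))
            (hy n (ℕ.m⊔n≤o⇒n≤o M′ N′ (ℕ.m⊔n≤o⇒n≤o A B A≤n))))

  ℚₚ-commutativeRing : CommutativeRing 0ℓ 0ℓ
  ℚₚ-commutativeRing = record
    { Carrier = ℚₚ
    ; _≈_ = _≈ₚ_
    ; _+_ = _+ₚ_
    ; _*_ = _*ₚ_
    ; -_ = -ₚ_
    ; 0# = fromℚ 0ℚ
    ; 1# = fromℚ 1ℚ
    ; isCommutativeRing = record
      { isRing = record
        { +-isAbelianGroup = record
          { isGroup = record
            { isMonoid = record
              { isSemigroup = record
                { isMagma = record
                  { isEquivalence = record
                    { refl = λ {x} → pointwise {x} {x} λ _ → refl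
                    ; sym = λ {x} {y} → ≈ₚ-sym {x} {y}
                    ; trans = λ {x} {y} {z} → ≈ₚ-trans {x} {y} {z} }
                  ; ∙-cong = λ {x} {x′} {y} {y′} → +ₚ-cong {x} {x′} {y} {y′} }
                ; assoc = λ x y z → pointwise {(x +ₚ y) +ₚ z} {x +ₚ (y +ₚ z)}
                    λ n → ℚ.+-assoc (seq x n) (seq y n) (seq z n) }
              ; identity =
                  (λ x → pointwise {fromℚ 0ℚ +ₚ x} {x} λ n → ℚ.+-identityˡ (seq x n))
                , (λ x → pointwise {x +ₚ fromℚ 0ℚ} {x} λ n → ℚ.+-identityʳ (seq x n)) }
            ; inverse =
                (λ x → pointwise { -ₚ x +ₚ x} {fromℚ 0ℚ} λ n → ℚ.+-inverseˡ (seq x n))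
              , (λ x → pointwise {x +ₚ -ₚ x} {fromℚ 0ℚ} λ n → ℚ.+-inverseʳ (seq x n))
            ; ⁻¹-cong = λ {x} {y} → -ₚ-cong {x} {y} }
          ; comm = λ x y → pointwise {x +ₚ y} {y +ₚ x} λ n → ℚ.+-comm (seq x n) (seq y n) }
        ; *-cong = λ {x} {x′} {y} {y′} → *ₚ-cong {x} {x′} {y} {y′}
        ; *-assoc = λ x y z → pointwise {(x *ₚ y) *ₚ z} {x *ₚ (y *ₚ z)}
            λ n → ℚ.*-assoc (seq x n) (seq y n) (seq z n)
        ; *-identity =
            (λ x → pointwise {fromℚ 1ℚ *ₚ x} {x} λ n → ℚ.*-identityˡ (seq x n))
          , (λ x → pointwise {x *ₚ fromℚ 1ℚ} {x} λ n → ℚ.*-identityʳ (seq x n))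
        ; distrib =
            (λ x y z → pointwise {x *ₚ (y +ₚ z)} {x *ₚ y +ₚ x *ₚ z}
              λ n → ℚ.*-distribˡ-+ (seq x n) (seq y n) (seq z n))
          , (λ x y z → pointwise {(y +ₚ z) *ₚ x} {y *ₚ x +ₚ z *ₚ x}
              λ n → ℚ.*-distribʳ-+ (seq x n) (seq y n) (seq z n)) }
      ; *-comm = λ x y → pointwise {x *ₚ y} {y *ₚ x} λ n → ℚ.*-comm (seq x n) (seq y n) } }

  Closure : Pred ℚₚ 0ℓ → Pred ℚₚ 0ℓ
  Closure S x = ∀ k → ∃ λ y → S y × ∣ x +ₚ -ₚ y ∣ₚ≤p^- k

  -- { Lₙ₊ₖ / Lₙ : n ≥ 0, Lₙ ≠ 0 }
  ShiftRatios : (ℕ → ℤ) → ℕ → Pred ℚₚ 0ℓ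
  ShiftRatios L k y = ∃ λ n → Σ (L n ≢ 0ℤ) λ Lₙ≢0 → y ≈ₚ fromℚ (ratio (L (n ℕ.+ k)) (L n) Lₙ≢0)

  -- ℚₚ(√D) is ℚₚ itself, with a chosen root, when D is a square in ℚₚ, and
  -- ℚₚ[X]/(X² − D) otherwise.
  data SquareRoot (D : ℤ) : Set where
    inside  : (s : ℚₚ) → s *ₚ s ≈ₚ fromℚ (fromℤ D) → SquareRoot D
    outside : (∀ s → ¬ (s *ₚ s ≈ₚ fromℚ (fromℤ D))) → SquareRoot D

  ℚₚ⟨√⟩ : ∀ {D} → SquareRoot D → CommutativeRing 0ℓ 0ℓ
  ℚₚ⟨√⟩     (inside _ _) = ℚₚ-commutativeRing
  ℚₚ⟨√⟩ {D} (outside _)  = QuadraticAdjunction.adjunction ℚₚ-commutativeRing (fromℚ (fromℤ D))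

  embed : ∀ {D} (r : SquareRoot D) → ℚₚ → CommutativeRing.Carrier (ℚₚ⟨√⟩ r)
  embed (inside _ _) x = x
  embed (outside _)  x = x , fromℚ 0ℚ

  √ : ∀ {D} (r : SquareRoot D) → CommutativeRing.Carrier (ℚₚ⟨√⟩ r)
  √ (inside s _) = s
  √ (outside _)  = fromℚ 0ℚ , fromℚ 1ℚ

  √-squared : ∀ {D} (r : SquareRoot D) → let module K = CommutativeRing (ℚₚ⟨√⟩ r) in
              √ r K.* √ r K.≈ embed r (fromℚ (fromℤ D))
  √-squared     (inside _ s²≈D) = s²≈D
  √-squared {D} (outside _)     =
      solve 1 (λ d → con 0 :* con 0 :+ d :* (con 1 :* con 1) := d) R.refl (fromℚ (fromℤ D))
    , solve 0 (con 0 :* con 1 :+ con 1 :* con 0 := con 0) R.refl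
    where
    module R = CommutativeRing ℚₚ-commutativeRing
    open NatSolver R.commutativeSemiring

  module QuadraticField {D : ℤ} (r : SquareRoot D) where
    private
      module K = CommutativeRing (ℚₚ⟨√⟩ r)
    open K public using (Carrier; _≈_)
    open Exp K.semiring public using (_^_)

    rational : ℚ → Carrier
    rational q = embed r (fromℚ q)

    -- c₀ + c₁ z + ⋯ + cₙ₋₁ zⁿ⁻¹ + zⁿ for the coefficient list c₀ ∷ ⋯ ∷ cₙ₋₁ ∷ [].
    monic : List ℚₚ → Carrier → Carrier
    monic []       z = K.1#
    monic (c ∷ cs) z = embed r c K.+ z K.* monic cs z

    -- The ring of integers is the integral closure of ℤₚ = { c : |c|ₚ ≤ 1 }.
    Integral : Carrier → Set
    Integral z = ∃ λ cs → All (λ c → ∣ c ∣ₚ≤p^- 0) cs × monic cs z ≈ K.0#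

    infix 4 _∣ₒ_
    _∣ₒ_ : Carrier → Carrier → Set
    x ∣ₒ y = ∃ λ w → Integral w × y ≈ x K.* w

    -- The maximal ideal consists of the integral non-units.
    GeneratesMaximalIdeal : Carrier → Set
    GeneratesMaximalIdeal π =
      Integral π × ¬ (π ∣ₒ K.1#) × (∀ z → Integral z → ¬ (z ∣ₒ K.1#) → π ∣ₒ z)

    -- p generates the maximal ideal exactly when ℚₚ(√D) is ℚₚ or unramified
    -- over ℚₚ, and then π = p is required.  In the ramified case a generator
    -- is the same as an element with |π|ₚ = p^(-1/2).
    IsUniformizer : Carrier → Set
    IsUniformizer π =
      GeneratesMaximalIdeal π ×
      (GeneratesMaximalIdeal (rational (fromℤ (+ p))) → π ≈ rational (fromℤ (+ p)))

    IsOrderModulo : Carrier → Carrier → ℕ → Set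
    IsOrderModulo π u l =
      1 ≤ l × π ∣ₒ u ^ l K.- K.1# × (∀ m → 1 ≤ m → π ∣ₒ u ^ m K.- K.1# → l ≤ m)

    λ₁ λ₂ : ℤ → Carrier
    λ₁ a = (rational (fromℤ a) K.+ √ r) K.* rational ½
    λ₂ a = (rational (fromℤ a) K.- √ r) K.* rational ½

    IsQuotient : Carrier → Carrier → Carrier → Set
    IsQuotient u x y = u K.* y ≈ x

    -- (λ₂/λ₁)ˡ − 1 is not divisible by π², where l is the order of λ₂/λ₁ modulo π.
    NotDivisibleAtOrder : ℤ → Set
    NotDivisibleAtOrder a = ∃ λ π → ∃ λ u → ∃ λ l →
      IsUniformizer π × IsQuotient u (λ₂ a) (λ₁ a) × IsOrderModulo π u l ×
      ¬ (π ^ 2 ∣ₒ u ^ l K.- K.1#)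

{-# OPTIONS --safe #-}
module Submission where

-- If p divides Lα exactly once, then p^(k+1) divides L at p^k α exactly, and by
-- Hensel lifting, for p ∣ u and p ∤ w, the value w Lₙ − u Lₙ₊₁ at some multiple n of α
-- is divisible by any prescribed power of p.  In other words the quotients Lₙ / Lₙ₊₁
-- with α ∣ n are dense in p ℤₚ.  By the addition formula
-- Lₙ₊α / Lₙ = Lα₋₁ + Lα Lₙ₊₁ / Lₙ, so the quotients of the first kind with α ∣ n are
-- dense outside the residue class of Lα₋₁ modulo p, and those of the second kind with
-- α ∣ n − 1 are dense inside it.
--
-- It remains to see that p² ∤ Lα.  If p ∣ D then α = p and this follows from the
-- binomial expansion of 2ᵖ Lₚ.  If p ∤ D the integral elements of ℚₚ(√D) are those
-- of ℤₚ[√D]; since (λ₂/λ₁)ⁿ − 1 is Lₙ times a unit, the order l equals α, and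
-- p² ∣ Lα would make (λ₂/λ₁)ˡ − 1 divisible by π².

open import Algebra.Bundles using (CommutativeRing)
import Algebra.Properties.Group
import Algebra.Properties.Semiring.Exp as Exp
import Algebra.Solver.Ring as RingSolver
open import Algebra.Solver.Ring.AlmostCommutativeRing using (fromCommutativeRing; _-Raw-AlmostCommutative⟶_)
import Algebra.Solver.Ring.NaturalCoefficients.Default as NatSolver
open import Data.Empty using (⊥-elim)
open import Data.Integer.Base as ℤ using (ℤ; +_; -[1+_]; 0ℤ; 1ℤ)
open import Data.Integer.DivMod using (_%ℕ_; _/ℕ_; n%ℕd<d; a≡a%ℕn+[a/ℕn]*n)
import Data.Integer.Divisibility.Signed as Signed
import Data.Integer.Properties as ℤ
open import Data.Integer.Tactic.RingSolver using (solve-∀)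
open import Data.List.Base using (List; []; _∷_; length)
open import Data.List.Relation.Unary.All using (All; []; _∷_)
open import Data.Maybe.Base using (Maybe; just; nothing)
open import Data.Nat.Base as ℕ using (ℕ; zero; suc; _≤_; _<_; _⊔_; s≤s; z≤n)
open import Data.Nat.Coprimality as Coprime using (Coprime; coprime-Bézout)
import Data.Nat.Divisibility as ℕ
open import Data.Nat.GCD using (module Bézout)
open import Data.Nat.Induction using (<-wellFounded)
open import Data.Nat.Primality using (Prime; euclidsLemma; prime⇒irreducible; prime⇒nonTrivial; prime⇒nonZero)
import Data.Nat.Properties as ℕ
open import Data.Product.Base using (Σ; _×_; _,_; ∃; ∃₂; proj₁; proj₂)
open import Data.Rational.Base as ℚ using (ℚ; mkℚ; 0ℚ; 1ℚ; ½; ↥_; ↧_; ↧ₙ_)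
import Data.Rational.Properties as ℚ
open import Data.Rational.Solver using (module +-*-Solver)
open import Data.Sum.Base using (_⊎_; inj₁; inj₂; [_,_]′)
open import Data.Unit.Base using (tt)
open import Induction.WellFounded using (Acc; acc)
open import Level using (0ℓ)
open import Relation.Binary.PropositionalEquality as ≡ using (_≡_; _≢_; cong; cong₂)
open import Relation.Nullary using (¬_; yes; no)
open import Relation.Nullary.Decidable using (decidable-stable; from-no)
open import Relation.Unary using (_∪_; _≐_; U)
open import Defs

-- A simple zero and two shifts are needed for the following reason. For `α` dividing n, the
-- reciprocals of the elements of p ℤₚ approximated by Lₙ / Lₙ₊₁ have absolute value at least p.
-- Since p divides Lα exactly once, multiplying by Lα turns this into absolute value at least 1, and
-- adding Lα₋₁ leaves out precisely the class Lα₋₁ + p ℤₚ. That class comes from Lₙ₊₁₊γ / Lₙ₊₁ =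
-- Lα₋₁ + Lγ Lₙ / Lₙ₊₁ with γ = α - 2, where Lγ is a p-adic unit because γ < α. If p² divided Lα,
-- these quotients would stay inside Lα₋₁ + p² ℤₚ.
--
-- The density argument takes place in ℤ: expansions of powers of the companion matrix replace the
-- p-adic logarithm, so no distinction between split, inert and ramified p is made there. ℚₚ(√D)
-- enters only through the hypothesis. As divisibility is phrased there by integral elements, the
-- integral closure has to be compared with an explicit lattice in both directions: once to use
-- given cofactors, once to supply new ones.

module LucasSequences where
  open import Data.Integer.Base using (_+_; _*_; _-_; _^_)
  open Signed
  open import Relation.Binary.PropositionalEquality using (refl; sym; trans; subst; module ≡-Reasoning)

  -- This is the binomial coefficient C(n,2), and `tetrahedral n` is C(n,3). Pascal's rule as the
  -- definition makes them fit the inductions below, and no division occurs.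
  triangular : ℕ → ℤ
  triangular zero    = 0ℤ
  triangular (suc n) = triangular n + + n

  tetrahedral : ℕ → ℤ
  tetrahedral zero    = 0ℤ
  tetrahedral (suc n) = tetrahedral n + triangular n

  2*triangular : ∀ n → + 2 * triangular n ≡ + n * (+ n - 1ℤ)
  2*triangular zero    = refl
  2*triangular (suc n) = trans (expand (triangular n) (+ n))
    (trans (cong (_+ + 2 * + n) (2*triangular n)) (collect (+ n)))
    where
    expand : ∀ t x → + 2 * (t + x) ≡ + 2 * t + + 2 * x
    expand = solve-∀
    collect : ∀ x → x * (x - 1ℤ) + + 2 * x ≡ (1ℤ + x) * (1ℤ + x - 1ℤ)
    collect = solve-∀

  6*tetrahedral : ∀ n → + 6 * tetrahedral n ≡ + n * ((+ n - 1ℤ) * (+ n - + 2))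
  6*tetrahedral zero    = refl
  6*tetrahedral (suc n) = trans (expand (tetrahedral n) (triangular n))
    (trans (cong₂ (λ u t → u + + 3 * t) (6*tetrahedral n) (2*triangular n)) (collect (+ n)))
    where
    expand : ∀ u t → + 6 * (u + t) ≡ + 6 * u + + 3 * (+ 2 * t)
    expand = solve-∀
    collect : ∀ x → x * ((x - 1ℤ) * (x - + 2)) + + 3 * (x * (x - 1ℤ))
                  ≡ (1ℤ + x) * ((1ℤ + x - 1ℤ) * (1ℤ + x - + 2))
    collect = solve-∀

  -- Addition formulas and expansions at multiples of an index

  module Lucas (a : ℤ) where

    L : ℕ → ℤ
    L = lucas a 1ℤ

    L-suc-+ : ∀ m n → L (suc (m ℕ.+ n)) ≡ L (suc m) * L (suc n) + L m * L n
    L-suc-+ zero n = lemma (L (suc n)) (L n)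
      where
      lemma : ∀ x y → x ≡ 1ℤ * x + 0ℤ * y
      lemma = solve-∀
    L-suc-+ (suc zero) n = lemma a (L (suc n)) (L n)
      where
      lemma : ∀ a x y → a * x + 1ℤ * y ≡ (a * 1ℤ + 1ℤ * 0ℤ) * x + 1ℤ * y
      lemma = solve-∀
    L-suc-+ (suc (suc m)) n =
      trans (cong₂ (λ x y → a * x + 1ℤ * y) (L-suc-+ (suc m) n) (L-suc-+ m n))
            (lemma a (L (suc m)) (L m) (L (suc n)) (L n))
      where
      lemma : ∀ a x y x′ y′ →
              a * ((a * x + 1ℤ * y) * x′ + x * y′) + 1ℤ * (x * x′ + y * y′)
            ≡ (a * (a * x + 1ℤ * y) + 1ℤ * x) * x′ + (a * x + 1ℤ * y) * y′
      lemma = solve-∀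

    -- The continuation of L to the predecessor of n, which for n = 0 is L₋₁ = 1.
    Lpred : ℕ → ℤ
    Lpred n = L (suc n) - a * L n

    L-+ : ∀ m n → L (m ℕ.+ n) ≡ L m * L (suc n) + L n * Lpred m
    L-+ zero n = lemma a (L (suc n)) (L n)
      where
      lemma : ∀ a x y → y ≡ 0ℤ * x + y * (1ℤ - a * 0ℤ)
      lemma = solve-∀
    L-+ (suc m) n = trans (L-suc-+ m n) (lemma a (L (suc m)) (L m) (L (suc n)) (L n))
      where
      lemma : ∀ a x y x′ y′ → x * x′ + y * y′ ≡ x * x′ + y′ * (a * x + 1ℤ * y - a * x)
      lemma = solve-∀

    consecutive-coprime : ∀ {d} n → d ∣ L n → d ∣ L (suc n) → d ∣ 1ℤ
    consecutive-coprime zero    _   d∣1 = d∣1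
    consecutive-coprime {d} (suc n) d∣x d∣y = consecutive-coprime n
      (subst (d ∣_) (lemma (a * L (suc n)) (L n)) (∣m∣n⇒∣m-n d∣y (∣n⇒∣m*n a d∣x))) d∣x
      where
      lemma : ∀ x y → x + 1ℤ * y - x ≡ y
      lemma = solve-∀

    -- With M the companion matrix, M^q = e + y M, and the expansions below are
    -- those of (e + y M)^j up to second order in y.
    module Multiples (q : ℕ) where
      private
        y = L q
        e = Lpred q

      L-multiple : ∀ j → y ∣ L (j ℕ.* q)
      L-multiple zero    = divides 0ℤ refl
      L-multiple (suc j) = subst (y ∣_) (sym (L-+ q (j ℕ.* q)))
        (∣m∣n⇒∣m+n (∣m⇒∣m*n (L (suc (j ℕ.* q))) (divides 1ℤ (lemma y))) (∣m⇒∣m*n e (L-multiple j)))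
        where
        lemma : ∀ y → y ≡ 1ℤ * y
        lemma = solve-∀

      -- The linear map Mⁱ ↦ Lᵢ₊₁ sends 1 to 1 and M to a; it is applied to (e + y M)^j = e^j + j
      -- e^(j-1) y M + O(y²). The factor e on the left avoids the exponent j - 1.
      L-suc-multiple : ∀ j → ∃ λ r →
        e * L (suc (j ℕ.* q)) ≡ e * e ^ j + + j * e ^ j * a * y + y * y * r
      L-suc-multiple zero = 0ℤ , lemma e a y
        where
        lemma : ∀ e a y → e * 1ℤ ≡ e * 1ℤ + 0ℤ * 1ℤ * a * y + y * y * 0ℤ
        lemma = solve-∀
      L-suc-multiple (suc j) with L-suc-multiple j | L-multiple j
      ... | r , er | divides z ez =
        (r * (e + a * y) + + j * e ^ j * a * a + e * z) , (begin
        e * L (suc (q ℕ.+ j ℕ.* q))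
          ≡⟨ cong (e *_) (L-suc-+ q (j ℕ.* q)) ⟩
        e * (L (suc q) * f + y * L (j ℕ.* q))
          ≡⟨ lemma₁ a (L (suc q)) y f (L (j ℕ.* q)) ⟩
        (e + a * y) * (e * f) + e * y * L (j ℕ.* q)
          ≡⟨ cong₂ (λ s t → (e + a * y) * s + e * y * t) er ez ⟩
        (e + a * y) * (e * E + + j * E * a * y + y * y * r) + e * y * (z * y)
          ≡⟨ lemma₂ a e y E (+ j) r z ⟩
        e * (e * E) + (1ℤ + + j) * (e * E) * a * y
          + y * y * (r * (e + a * y) + + j * E * a * a + e * z) ∎)
        where
        open ≡-Reasoning
        f = L (suc (j ℕ.* q))
        E = e ^ j
        lemma₁ : ∀ a h y f t → (h - a * y) * (h * f + y * t)
                             ≡ (h - a * y + a * y) * ((h - a * y) * f) + (h - a * y) * y * t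
        lemma₁ = solve-∀
        lemma₂ : ∀ a e y E j r z →
          (e + a * y) * (e * E + j * E * a * y + y * y * r) + e * y * (z * y)
          ≡ e * (e * E) + (1ℤ + j) * (e * E) * a * y
            + y * y * (r * (e + a * y) + j * E * a * a + e * z)
        lemma₂ = solve-∀

      -- The map Mⁱ ↦ Lᵢ sends 1, M, M² to 0, 1, a, and e² avoids the exponent j - 2. The
      -- coefficient of y² is kept explicit because for j = p its divisibility by p is needed.
      L-multiple-expansion : ∀ j → ∃ λ s →
        e * e * L (j ℕ.* q)
          ≡ + j * (e * e ^ j) * y + triangular j * e ^ j * a * y * y + y * y * y * s
      L-multiple-expansion zero = 0ℤ , lemma e a y
        where
        lemma : ∀ e a y → e * e * 0ℤ ≡ 0ℤ * (e * 1ℤ) * y + 0ℤ * 1ℤ * a * y * y + y * y * y * 0ℤ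
        lemma = solve-∀
      L-multiple-expansion (suc j) with L-suc-multiple j | L-multiple-expansion j
      ... | r , er | s , es = (e * r + e * s) , (begin
        e * e * L (q ℕ.+ j ℕ.* q)
          ≡⟨ cong (e * e *_) (L-+ q (j ℕ.* q)) ⟩
        e * e * (y * f + t * e)
          ≡⟨ lemma₁ e y f t ⟩
        e * y * (e * f) + e * (e * e * t)
          ≡⟨ cong₂ (λ u v → e * y * u + e * v) er es ⟩
        e * y * (e * E + + j * E * a * y + y * y * r)
          + e * (+ j * (e * E) * y + triangular j * E * a * y * y + y * y * y * s)
          ≡⟨ lemma₂ a e y E (+ j) (triangular j) r s ⟩
        (1ℤ + + j) * (e * (e * E)) * y + (triangular j + + j) * (e * E) * a * y * y
          + y * y * y * (e * r + e * s) ∎)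
        where
        open ≡-Reasoning
        f = L (suc (j ℕ.* q))
        t = L (j ℕ.* q)
        E = e ^ j
        lemma₁ : ∀ e y f t → e * e * (y * f + t * e) ≡ e * y * (e * f) + e * (e * e * t)
        lemma₁ = solve-∀
        lemma₂ : ∀ a e y E j t r s →
          e * y * (e * E + j * E * a * y + y * y * r)
            + e * (j * (e * E) * y + t * E * a * y * y + y * y * y * s)
          ≡ (1ℤ + j) * (e * (e * E)) * y + (t + j) * (e * E) * a * y * y
            + y * y * y * (e * r + e * s)
        lemma₂ = solve-∀

    -- Since λ₁ − λ₂ = √D and 2λ = a ± √D, the binomial theorem gives
    -- 2ⁿ Lₙ = 2 Σ_{i odd} C(n,i) aⁿ⁻ⁱ D^((i−1)/2); the terms from i = 5 on
    -- are multiples of D².  Here C(n,3) is tetrahedral n, and a³ clears the denominator of aⁿ⁻³.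
    module Discriminant where
      D : ℤ
      D = a * a + + 4

      private
        main : ℕ → ℤ
        main n = + 2 * (+ n * (a * a * a ^ n) + tetrahedral n * a ^ n * D)

      L-mod-D² : ∀ n → ∃ λ r → a * a * a * ((+ 2) ^ n * L n) ≡ main n + D * D * r
      L-mod-D² zero = 0ℤ , lemma a
        where
        lemma : ∀ a → a * a * a * (1ℤ * 0ℤ)
              ≡ + 2 * (0ℤ * (a * a * 1ℤ) + 0ℤ * 1ℤ * (a * a + + 4))
                + (a * a + + 4) * (a * a + + 4) * 0ℤ
        lemma = solve-∀
      L-mod-D² (suc zero) = 0ℤ , lemma a
        where
        lemma : ∀ a → a * a * a * (+ 2 * 1ℤ * 1ℤ)
              ≡ + 2 * (1ℤ * (a * a * (a * 1ℤ)) + 0ℤ * (a * 1ℤ) * (a * a + + 4))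
                + (a * a + + 4) * (a * a + + 4) * 0ℤ
        lemma = solve-∀
      L-mod-D² (suc (suc n)) with L-mod-D² (suc n) | L-mod-D² n
      -- The sequence 2ⁿ Lₙ satisfies x² = 2 a x + 4, that is (S - a)² = D for the shift S. On
      -- `main`, (S - a)² kills n aⁿ and turns C(n,3) aⁿ into n aⁿ⁺², which cancels the D-term of
      -- the first summand; what remains is -2 D² C(n,3) aⁿ, whence the last summand of the witness.
      ... | r , er | s , es = (+ 2 * a * r + + 4 * s + + 2 * (tetrahedral n * E)) , (begin
        a * a * a * (+ 2 * (+ 2 * (+ 2) ^ n) * (a * L (suc n) + 1ℤ * L n))
          ≡⟨ lemma₁ a ((+ 2) ^ n) (L (suc n)) (L n) ⟩
        + 2 * a * (a * a * a * (+ 2 * (+ 2) ^ n * L (suc n))) + + 4 * (a * a * a * ((+ 2) ^ n * L n))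
          ≡⟨ cong₂ (λ u v → + 2 * a * u + + 4 * v) er es ⟩
        + 2 * a * (main (suc n) + D * D * r) + + 4 * (main n + D * D * s)
          ≡⟨ lemma₂ a E (+ n) (triangular n) (tetrahedral n) r s ⟩
        main (suc (suc n)) + D * D * (+ 2 * a * r + + 4 * s + + 2 * (tetrahedral n * E)) ∎)
        where
        open ≡-Reasoning
        E = a ^ n
        lemma₁ : ∀ a w x y → a * a * a * (+ 2 * (+ 2 * w) * (a * x + 1ℤ * y))
               ≡ + 2 * a * (a * a * a * (+ 2 * w * x)) + + 4 * (a * a * a * (w * y))
        lemma₁ = solve-∀
        lemma₂ : ∀ a E n t u r s →
          + 2 * a * (+ 2 * ((1ℤ + n) * (a * a * (a * E)) + (u + t) * (a * E) * (a * a + + 4))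
                     + (a * a + + 4) * (a * a + + 4) * r)
            + + 4 * (+ 2 * (n * (a * a * E) + u * E * (a * a + + 4)) + (a * a + + 4) * (a * a + + 4) * s)
          ≡ + 2 * ((1ℤ + (1ℤ + n)) * (a * a * (a * (a * E)))
                   + (u + t + (t + n)) * (a * (a * E)) * (a * a + + 4))
            + (a * a + + 4) * (a * a + + 4) * (+ 2 * a * r + + 4 * s + + 2 * (u * E))
        lemma₂ = solve-∀

open LucasSequences

-- Divisibility by powers of a prime

module PrimeArithmetic where
  open import Data.Integer.Base using (_+_; _*_; _-_; -_; _^_; NonZero)
  open Signed
  open import Relation.Binary.PropositionalEquality using (refl; sym; trans; subst; subst₂; module ≡-Reasoning)

  module PrimePowers (p : ℕ) (p-prime : Prime p) where

    P : ℤ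
    P = + p

    infix 8 P^_
    P^_ : ℕ → ℤ
    P^ k = + (p ℕ.^ k)

    instance
      p-nonZero : ℕ.NonZero p
      p-nonZero = prime⇒nonZero p-prime

    P^-nonZero : ∀ k → NonZero (P^ k)
    P^-nonZero k = ℕ.m^n≢0 p k

    P^-suc : ∀ k → P^ suc k ≡ P * P^ k
    P^-suc k = ℤ.pos-* p (p ℕ.^ k)

    P^1 : P^ 1 ≡ P
    P^1 = cong +_ (ℕ.*-identityʳ p)

    P^2 : P^ 2 ≡ P * P
    P^2 = trans (P^-suc 1) (cong (P *_) P^1)

    P^suc∣⇒P∣ : ∀ k {x} → P^ suc k ∣ x → P ∣ x
    P^suc∣⇒P∣ k {x} h = ∣-trans (divides (P^ k) (trans (P^-suc k) (ℤ.*-comm P (P^ k)))) h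

    ∤1 : ¬ P ∣ 1ℤ
    ∤1 h = ℕ.nonTrivial⇒≢1 {{prime⇒nonTrivial p-prime}} (ℕ.∣1⇒≡1 (∣⇒∣ᵤ h))

    ∣-* : ∀ x y → P ∣ x * y → P ∣ x ⊎ P ∣ y
    ∣-* x y h with euclidsLemma _ _ p-prime (subst (p ℕ.∣_) (ℤ.abs-* x y) (∣⇒∣ᵤ h))
    ... | inj₁ h₁ = inj₁ (∣ᵤ⇒∣ h₁)
    ... | inj₂ h₂ = inj₂ (∣ᵤ⇒∣ h₂)

    ∤-* : ∀ {x y} → ¬ P ∣ x → ¬ P ∣ y → ¬ P ∣ x * y
    ∤-* {x} {y} hx hy h = [ hx , hy ]′ (∣-* x y h)

    ∤-^ : ∀ {x} n → ¬ P ∣ x → ¬ P ∣ x ^ n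
    ∤-^ zero    hx = ∤1
    ∤-^ (suc n) hx = ∤-* hx (∤-^ n hx)

    P^-cancelˡ : ∀ k w {x} → ¬ P ∣ w → P^ k ∣ w * x → P^ k ∣ x
    P^-cancelˡ zero    w {x} _ _ = divides x (sym (ℤ.*-identityʳ x))
    P^-cancelˡ (suc k) w {x} hw h with ∣-* w x (P^suc∣⇒P∣ k h)
    ... | inj₁ P∣w = ⊥-elim (hw P∣w)
    ... | inj₂ (divides x′ refl) = subst₂ _∣_ (sym (P^-suc k)) (ℤ.*-comm P x′)
      (*-monoʳ-∣ P (P^-cancelˡ k w hw
        (*-cancelˡ-∣ P (subst₂ _∣_ (P^-suc k) (lemma w x′ P) h))))
      where
      lemma : ∀ w x P → w * (x * P) ≡ P * (w * x)
      lemma = solve-∀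

    p-coprime : ∀ {n} → ¬ p ℕ.∣ n → Coprime p n
    p-coprime p∤n (d∣p , d∣n) with prime⇒irreducible p-prime d∣p
    ... | inj₁ d≡1 = d≡1
    ... | inj₂ refl = ⊥-elim (p∤n d∣n)

    private
      inverse-ℕ : ∀ n → ¬ p ℕ.∣ n → ∃ λ i → P ∣ + n * i - 1ℤ
      inverse-ℕ n p∤n with coprime-Bézout (p-coprime p∤n)
      ... | Bézout.+- x y eq = - + y , divides (- + x) (begin
          + n * - + y - 1ℤ        ≡⟨ lemma (+ n) (+ y) ⟩
          - (1ℤ + + y * + n)      ≡⟨ cong (λ z → - (1ℤ + z)) (sym (ℤ.pos-* y n)) ⟩
          - (+ (1 ℕ.+ y ℕ.* n))   ≡⟨ cong (λ z → - (+ z)) eq ⟩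
          - (+ (x ℕ.* p))         ≡⟨ cong -_ (ℤ.pos-* x p) ⟩
          - (+ x * P)             ≡⟨ ℤ.neg-distribˡ-* (+ x) P ⟩
          - + x * P               ∎)
        where
        open ≡-Reasoning
        lemma : ∀ n y → n * - y - 1ℤ ≡ - (1ℤ + y * n)
        lemma = solve-∀
      ... | Bézout.-+ x y eq = + y , divides (+ x) (begin
          + n * + y - 1ℤ          ≡⟨ cong (_- 1ℤ) (trans (ℤ.*-comm (+ n) (+ y)) (sym (ℤ.pos-* y n))) ⟩
          + (y ℕ.* n) - 1ℤ        ≡⟨ cong (λ z → + z - 1ℤ) (sym eq) ⟩
          1ℤ + + (x ℕ.* p) - 1ℤ   ≡⟨ cong (λ z → 1ℤ + z - 1ℤ) (ℤ.pos-* x p) ⟩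
          1ℤ + + x * P - 1ℤ       ≡⟨ lemma (+ x * P) ⟩
          + x * P                 ∎)
        where
        open ≡-Reasoning
        lemma : ∀ z → 1ℤ + z - 1ℤ ≡ z
        lemma = solve-∀

    inverse : ∀ c → ¬ P ∣ c → ∃ λ i → P ∣ c * i - 1ℤ
    inverse (+ n)      P∤c = inverse-ℕ n (λ h → P∤c (∣ᵤ⇒∣ h))
    inverse (-[1+ n ]) P∤c with inverse-ℕ (suc n) (λ h → P∤c (∣ᵤ⇒∣ h))
    ... | i , h = - i , subst (λ z → P ∣ z - 1ℤ) (lemma (+ suc n) i) h
      where
      lemma : ∀ n i → n * i ≡ (- n) * (- i)
      lemma = solve-∀

    linear-congruence : ∀ c g → ¬ P ∣ c → ∃ λ j → P ∣ g + + j * c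
    linear-congruence c g P∤c with inverse c P∤c
    -- The solution -g c⁻¹ is reduced modulo p to a natural number, since it will multiply an index.
    ... | i , h = z %ℕ p , subst (P ∣_)
          (trans (lemma g c i (z /ℕ p) P) (cong (λ t → g + t * c) j≡))
          (∣m∣n⇒∣m-n (∣n⇒∣m*n (- g) h) (∣n⇒∣m*n (z /ℕ p * c) ∣-refl))
      where
      z = - g * i
      lemma : ∀ g c i t P → - g * (c * i - 1ℤ) - t * c * P ≡ g + (- g * i - t * P) * c
      lemma = solve-∀
      lemma′ : ∀ j t → j + t - t ≡ j
      lemma′ = solve-∀
      j≡ : z - z /ℕ p * P ≡ + (z %ℕ p)
      j≡ = trans (cong (_- z /ℕ p * P) (a≡a%ℕn+[a/ℕn]*n z p)) (lemma′ (+ (z %ℕ p)) (z /ℕ p * P))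

    factor-P : ∀ n .{{_ : ℕ.NonZero n}} → ∃₂ λ e d → ¬ P ∣ d × + n ≡ P^ e * d
    factor-P n = go n (<-wellFounded n)
      where
      go : ∀ n .{{_ : ℕ.NonZero n}} → Acc _<_ n → ∃₂ λ e d → ¬ P ∣ d × + n ≡ P^ e * d
      go n (acc rs) with p ℕ.∣? n
      ... | no p∤n = 0 , + n , (λ h → p∤n (∣⇒∣ᵤ h)) , sym (ℤ.*-identityˡ (+ n))
      ... | yes (ℕ.divides-refl m) =
        let instance _ = ℕ.m*n≢0⇒m≢0 m {p}
            e , d , P∤d , m≡ = go m (rs (ℕ.m<m*n m p (ℕ.nonTrivial⇒n>1 p {{prime⇒nonTrivial p-prime}})))
        in suc e , d , P∤d , (begin
             + (m ℕ.* p)      ≡⟨ ℤ.pos-* m p ⟩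
             + m * P          ≡⟨ cong (_* P) m≡ ⟩
             P^ e * d * P     ≡⟨ lemma (P^ e) d P ⟩
             P * P^ e * d     ≡⟨ cong (_* d) (sym (P^-suc e)) ⟩
             P^ suc e * d     ∎)
        where
        open ≡-Reasoning
        lemma : ∀ x d P → x * d * P ≡ P * x * d
        lemma = solve-∀

  -- The residue -4 = 2 is not a square modulo 3. This keeps p = 3 out of the ramified case, where
  -- C(3,3) = 1 would not be divisible by p.
  3∤a²+4 : ∀ a → ¬ + 3 ∣ a * a + + 4
  3∤a²+4 a h with a %ℕ 3 | a /ℕ 3 | n%ℕd<d a 3 | a≡a%ℕn+[a/ℕn]*n a 3
  ... | r | t | r<3 | refl = small r r<3
    (∣m+n∣n⇒∣m (subst (+ 3 ∣_) (lemma (+ r) t) h) (∣n⇒∣m*n (+ 2 * + r * t + t * t * + 3) ∣-refl))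
    where
    lemma : ∀ r t → (r + t * + 3) * (r + t * + 3) + + 4
          ≡ r * r + + 4 + (+ 2 * r * t + t * t * + 3) * + 3
    lemma = solve-∀
    small : ∀ r → r < 3 → ¬ + 3 ∣ + r * + r + + 4
    small 0 _ = from-no (+ 3 ∣? + 4)
    small 1 _ = from-no (+ 3 ∣? + 5)
    small 2 _ = from-no (+ 3 ∣? + 8)
    small (suc (suc (suc _))) (s≤s (s≤s (s≤s ())))

  module OddPrime (p : ℕ) (p-prime : Prime p) (3≤p : 3 ≤ p) where
    open PrimePowers p p-prime

    ∤2 : ¬ P ∣ + 2
    ∤2 h = ℕ.<-irrefl refl (ℕ.≤-trans 3≤p (ℕ.∣⇒≤ (∣⇒∣ᵤ h)))

    P∣triangular : P ∣ triangular p
    P∣triangular with ∣-* (+ 2) (triangular p)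
      (subst (P ∣_) (sym (2*triangular p)) (∣m⇒∣m*n (P - 1ℤ) ∣-refl))
    ... | inj₁ h = ⊥-elim (∤2 h)
    ... | inj₂ h = h

    P∣tetrahedral : p ≢ 3 → P ∣ tetrahedral p
    P∣tetrahedral p≢3 with ∣-* (+ 6) (tetrahedral p)
      (subst (P ∣_) (sym (6*tetrahedral p)) (∣m⇒∣m*n ((P - 1ℤ) * (P - + 2)) ∣-refl))
    ... | inj₁ h = ⊥-elim (∤-* {+ 2} {+ 3} ∤2 ∤3 h)
      where
      ∤3 : ¬ P ∣ + 3
      ∤3 h = p≢3 (ℕ.≤-antisym (ℕ.∣⇒≤ (∣⇒∣ᵤ h)) 3≤p)
    ... | inj₂ h = h

    -- Hensel lifting along multiples of a simple zero

    module SimpleZero (a : ℤ) (α : ℕ) (P∣Lα : P ∣ lucas a 1ℤ α) (P²∤Lα : ¬ P^ 2 ∣ lucas a 1ℤ α) where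
      open Lucas a

      P∤L-suc : ∀ n → P ∣ L n → ¬ P ∣ L (suc n)
      P∤L-suc n h h′ = ∤1 (consecutive-coprime n h h′)

      P∤Lpred : ∀ n → P ∣ L n → ¬ P ∣ Lpred n
      P∤Lpred n h h′ = P∤L-suc n h (∣m+n∣n⇒∣m h′ (∣m⇒∣-m (∣n⇒∣m*n a h)))

      P∣L-multiple : ∀ m → P ∣ L (m ℕ.* α)
      P∣L-multiple m = ∣-trans P∣Lα (Multiples.L-multiple α m)

      -- In the expansion at j = p, with y of valuation k + 1, the linear term has valuation exactly
      -- k + 2. The quadratic one has at least 2k + 3, as p divides C(p,2) for odd p, and the cubic
      -- one at least 3k + 3; both exceed k + 2.
      exact : ∀ k → ∃ λ c → ¬ P ∣ c × L (p ℕ.^ k ℕ.* α) ≡ P^ suc k * c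
      exact zero = c , P∤c , (begin
          L (1 ℕ.* α)     ≡⟨ cong L (ℕ.*-identityˡ α) ⟩
          L α             ≡⟨ eq ⟩
          c * P           ≡⟨ ℤ.*-comm c P ⟩
          P * c           ≡⟨ cong (_* c) (sym P^1) ⟩
          P^ 1 * c        ∎)
        where
        open ≡-Reasoning
        c = quotient P∣Lα
        eq : L α ≡ c * P
        eq = _∣_.equality P∣Lα
        P∤c : ¬ P ∣ c
        P∤c P∣c = P²∤Lα (subst₂ _∣_ (sym P^2) (sym eq) (*-monoˡ-∣ P P∣c))
      exact (suc k) with exact k | P∣triangular
      ... | c , P∤c , y≡ | divides t t≡ with Multiples.L-multiple-expansion (p ℕ.^ k ℕ.* α) p
      ... | s , expansion = z , P∤z , trans (cong L q′≡) (trans Lq′≡ (ℤ.*-comm z (P^ suc (suc k))))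
        where
        open ≡-Reasoning
        q = p ℕ.^ k ℕ.* α
        e = Lpred q
        E = e ^ p
        P∤e = P∤Lpred q (P∣L-multiple (p ℕ.^ k))
        q′≡ : p ℕ.^ suc k ℕ.* α ≡ p ℕ.* q
        q′≡ = ℕ.*-assoc p (p ℕ.^ k) α
        -- `R * P` is what the quadratic and cubic terms leave after c p^(k+2) is taken out.
        R = t * E * a * (P^ k * c) + P^ k * c * (P^ k * c) * s
        lemma : ∀ P e E t a K c s →
                P * (e * E) * (P * K * c) + t * P * E * a * (P * K * c) * (P * K * c)
                  + (P * K * c) * (P * K * c) * (P * K * c) * s
                ≡ c * (e * E + (t * E * a * (K * c) + K * c * (K * c) * s) * P) * (P * (P * K))
        lemma = solve-∀
        y≡′ : L q ≡ P * P^ k * c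
        y≡′ = trans y≡ (cong (_* c) (P^-suc k))
        expansion′ : e * e * L (p ℕ.* q) ≡ c * (e * E + R * P) * P^ suc (suc k)
        expansion′ = begin
          e * e * L (p ℕ.* q)
            ≡⟨ expansion ⟩
          P * (e * E) * L q + triangular p * E * a * L q * L q + L q * L q * L q * s
            ≡⟨ cong₂ (λ y t → P * (e * E) * y + t * E * a * y * y + y * y * y * s) y≡′ t≡ ⟩
          P * (e * E) * (P * P^ k * c) + t * P * E * a * (P * P^ k * c) * (P * P^ k * c)
            + (P * P^ k * c) * (P * P^ k * c) * (P * P^ k * c) * s
            ≡⟨ lemma P e E t a (P^ k) c s ⟩
          c * (e * E + R * P) * (P * (P * P^ k))
            ≡⟨ cong (c * (e * E + R * P) *_)
                 (sym (trans (P^-suc (suc k)) (cong (P *_) (P^-suc k)))) ⟩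
          c * (e * E + R * P) * P^ suc (suc k) ∎
        divisible : P^ suc (suc k) ∣ L (p ℕ.* q)
        divisible = P^-cancelˡ (suc (suc k)) (e * e) (∤-* P∤e P∤e) 
          (divides (c * (e * E + R * P)) expansion′)
        z = quotient divisible
        Lq′≡ : L (p ℕ.* q) ≡ z * P^ suc (suc k)
        Lq′≡ = _∣_.equality divisible
        z≡ : e * e * z ≡ c * (e * E + R * P)
        z≡ = ℤ.*-cancelʳ-≡ (e * e * z) (c * (e * E + R * P)) (P^ suc (suc k))
               {{P^-nonZero (suc (suc k))}}
               (trans (ℤ.*-assoc (e * e) z (P^ suc (suc k)))
                 (trans (cong (e * e *_) (sym Lq′≡)) expansion′))
        P∤z : ¬ P ∣ z
        P∤z P∣z = ∤-* P∤c (λ h → ∤-* P∤e (∤-^ p P∤e) (∣m+n∣n⇒∣m h (divides R refl)))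
                    (subst (P ∣_) z≡ (∣n⇒∣m*n (e * e) P∣z))

      module Approximation (w u : ℤ) (P∤w : ¬ P ∣ w) (P∣u : P ∣ u) where

        -- When p ∤ Lₙ₊₁, divisibility of `G n` by a power of p says that Lₙ / Lₙ₊₁ is congruent to
        -- u / w modulo that power.
        G : ℕ → ℤ
        G n = w * L n - u * L (suc n)

        -- `G` is a combination of L and its shift, so it inherits the recurrence and with it the
        -- addition formula.
        G-+ : ∀ q n → G (q ℕ.+ n) ≡ G n * Lpred q + L q * G (suc n)
        G-+ q n = trans (cong₂ (λ x y → w * x - u * y) (L-+ q n) (L-suc-+ q n))
          (lemma a w u (L n) (L (suc n)) (L q) (L (suc q)))
          where
          lemma : ∀ a w u x f y g →
                  w * (y * f + x * (g - a * y)) - u * (g * f + y * x)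
                ≡ (w * x - u * f) * (g - a * y) + y * (w * f - u * (a * f + 1ℤ * x))
          lemma = solve-∀

        -- This unit plays the part of the derivative in Hensel's lemma: it is a factor of the
        -- coefficient of j in the congruence to be solved.
        P∤G-suc : ∀ m → ¬ P ∣ G (suc (m ℕ.* α))
        P∤G-suc m h = ∤-* P∤w (P∤L-suc (m ℕ.* α) (P∣L-multiple m))
          (∣m+n∣n⇒∣m h (∣m⇒∣-m (∣m⇒∣m*n (L (suc (suc (m ℕ.* α)))) P∣u)))

        -- Moving n by j p^k α changes G n / p^(k+1) modulo p, up to units, by a
        -- nonzero multiple of j.
        step : ∀ k m g c j → G (m ℕ.* α) ≡ g * P^ suc k →
               L (p ℕ.^ k ℕ.* α) ≡ P^ suc k * c →
               P ∣ Lpred (p ℕ.^ k ℕ.* α) * g + + j * (c * G (suc (m ℕ.* α))) →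
               P^ suc (suc k) ∣ G ((j ℕ.* p ℕ.^ k ℕ.+ m) ℕ.* α)
        step k m g c j G≡ y≡ h = subst (λ n → P^ suc (suc k) ∣ G n) n′≡
            (P^-cancelˡ (suc (suc k)) (e * e) (∤-* P∤e P∤e)
              (subst (P^ suc (suc k) ∣_) (sym expansion) divisible))
          where
          open ≡-Reasoning
          q = p ℕ.^ k ℕ.* α
          n = m ℕ.* α
          e = Lpred q
          E = e ^ j
          K = P^ suc k
          y₀ = P^ k * c
          G₁ = G (suc n)
          P∤e = P∤Lpred q (P∣L-multiple (p ℕ.^ k))
          n′≡ : j ℕ.* q ℕ.+ n ≡ (j ℕ.* p ℕ.^ k ℕ.+ m) ℕ.* α
          n′≡ = trans (cong (ℕ._+ n) (sym (ℕ.*-assoc j (p ℕ.^ k) α)))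
                      (sym (ℕ.*-distribʳ-+ α (j ℕ.* p ℕ.^ k) m))
          open Multiples q
          z = quotient (L-multiple j)
          r = proj₁ (L-suc-multiple j)
          s = proj₁ (L-multiple-expansion j)
          y≡P : L q ≡ P * y₀
          y≡P = trans y≡ (trans (cong (_* c) (P^-suc k)) (ℤ.*-assoc P (P^ k) c))
          -- With y = `L q`, e times `Lpred (j q)` is e E + y A, and e² times `L (j q)` is y (j e E
          -- + y B). Since y = P y₀, the contributions of A and B carry an additional factor p and
          -- form `C * P`.
          A = + j * E * a + L q * r - a * e * z
          B = triangular j * E * a + L q * s
          C = e * g * y₀ * A + c * y₀ * B * G₁
          bracket = e * E * (e * g + + j * (c * G₁)) + C * P
          lemma₁ : ∀ e a G₀ G₁ f y → e * e * (G₀ * (f - a * y) + y * G₁)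
                 ≡ e * G₀ * (e * f - a * e * y) + e * e * y * G₁
          lemma₁ = solve-∀
          lemma₂ : ∀ e a G₀ G₁ E j y r z t s →
            e * G₀ * (e * E + j * E * a * y + y * y * r - a * e * (z * y))
              + (j * (e * E) * y + t * E * a * y * y + y * y * y * s) * G₁
            ≡ e * G₀ * (e * E + y * (j * E * a + y * r - a * e * z))
              + y * (j * (e * E) + y * (t * E * a + y * s)) * G₁
          lemma₂ = solve-∀
          lemma₃ : ∀ e G₁ E j g K c y₀ P A B →
            e * (g * K) * (e * E + P * y₀ * A) + K * c * (j * (e * E) + P * y₀ * B) * G₁
            ≡ K * (e * E * (e * g + j * (c * G₁)) + (e * g * y₀ * A + c * y₀ * B * G₁) * P)
          lemma₃ = solve-∀
          expansion : e * e * G (j ℕ.* q ℕ.+ n) ≡ K * bracket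
          expansion = begin
            e * e * G (j ℕ.* q ℕ.+ n)
              ≡⟨ cong (e * e *_) (G-+ (j ℕ.* q) n) ⟩
            e * e * (G n * (L (suc (j ℕ.* q)) - a * L (j ℕ.* q)) + L (j ℕ.* q) * G₁)
              ≡⟨ lemma₁ e a (G n) G₁ (L (suc (j ℕ.* q))) (L (j ℕ.* q)) ⟩
            e * G n * (e * L (suc (j ℕ.* q)) - a * e * L (j ℕ.* q)) + e * e * L (j ℕ.* q) * G₁
              ≡⟨ cong₂ (λ f y → e * G n * (f - a * e * L (j ℕ.* q)) + y * G₁)
                   (proj₂ (L-suc-multiple j)) (proj₂ (L-multiple-expansion j)) ⟩
            e * G n * (e * E + + j * E * a * L q + L q * L q * r - a * e * L (j ℕ.* q))
              + (+ j * (e * E) * L q + triangular j * E * a * L q * L q + L q * L q * L q * s) * G₁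
              ≡⟨ cong (λ y → e * G n * (e * E + + j * E * a * L q + L q * L q * r - a * e * y)
              + (+ j * (e * E) * L q + triangular j * E * a * L q * L q + L q * L q * L q * s) * G₁)
                   (_∣_.equality (L-multiple j)) ⟩
            e * G n * (e * E + + j * E * a * L q + L q * L q * r - a * e * (z * L q))
              + (+ j * (e * E) * L q + triangular j * E * a * L q * L q + L q * L q * L q * s) * G₁
              ≡⟨ lemma₂ e a (G n) G₁ E (+ j) (L q) r z (triangular j) s ⟩
            e * G n * (e * E + L q * A) + L q * (+ j * (e * E) + L q * B) * G₁
              ≡⟨ cong₂ (λ x y → e * x * (e * E + L q * A) + y * (+ j * (e * E) + L q * B) * G₁) G≡ y≡ ⟩
            e * (g * K) * (e * E + L q * A) + K * c * (+ j * (e * E) + L q * B) * G₁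
              ≡⟨ cong (λ y → e * (g * K) * (e * E + y * A) + K * c * (+ j * (e * E) + y * B) * G₁) y≡P ⟩
            e * (g * K) * (e * E + P * y₀ * A) + K * c * (+ j * (e * E) + P * y₀ * B) * G₁
              ≡⟨ lemma₃ e G₁ E (+ j) g K c y₀ P A B ⟩
            K * bracket ∎
          divisible : P^ suc (suc k) ∣ K * bracket
          divisible = subst (_∣ K * bracket) (trans (ℤ.*-comm K P) (sym (P^-suc (suc k))))
            (*-monoʳ-∣ K (∣m∣n⇒∣m+n (∣n⇒∣m*n (e * E) h) (divides C refl)))

        approximate : ∀ k → ∃ λ m → P^ suc k ∣ G (m ℕ.* α)
        -- The lifting starts at index 0, where G is -u.
        approximate zero = 0 , subst (P^ 1 ∣_) (lemma w u)
          (∣m⇒∣-m (subst (_∣ u) (sym P^1) P∣u))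
          where
          lemma : ∀ w u → - u ≡ w * 0ℤ - u * 1ℤ
          lemma = solve-∀
        approximate (suc k) =
          let m , divides g G≡ = approximate k
              c , P∤c , y≡ = exact k
              j , h = linear-congruence (c * G (suc (m ℕ.* α))) (Lpred (p ℕ.^ k ℕ.* α) * g)
                        (∤-* P∤c (P∤G-suc m))
          in j ℕ.* p ℕ.^ k ℕ.+ m , step k m g c j G≡ y≡ h

    -- Primes dividing the discriminant

    module Ramified (a : ℤ) (P∤a : ¬ P ∣ a) (P∣D : P ∣ a * a + + 4) where
      open Lucas a
      open Discriminant

      private
        factor : ℕ → ℤ
        factor n = a * a * a * (+ 2) ^ n

        P∤factor : ∀ n → ¬ P ∣ factor n
        P∤factor n = ∤-* (∤-* (∤-* P∤a P∤a) P∤a) (∤-^ n ∤2)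

        P∤coefficient : ∀ n → ¬ P ∣ + 2 * (a * a * a ^ n)
        P∤coefficient n = ∤-* ∤2 (∤-* (∤-* P∤a P∤a) (∤-^ n P∤a))

        expansion : ∀ n → ∃ λ r → factor n * L n
                  ≡ + n * (+ 2 * (a * a * a ^ n)) + D * (+ 2 * a ^ n * tetrahedral n + D * r)
        expansion n with L-mod-D² n
        ... | r , eq = r , trans (ℤ.*-assoc (a * a * a) _ _)
              (trans eq (lemma (+ n) (a * a * a ^ n) (tetrahedral n) (a ^ n) D r))
          where
          lemma : ∀ n x t E D r → + 2 * (n * x + t * E * D) + D * D * r
                ≡ n * (+ 2 * x) + D * (+ 2 * E * t + D * r)
          lemma = solve-∀

      P∣L⇒P∣n : ∀ n → P ∣ L n → P ∣ + n
      P∣L⇒P∣n n h with expansion n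
      ... | r , eq with ∣-* (+ n) _ (∣m+n∣n⇒∣m (subst (P ∣_) eq (∣n⇒∣m*n (factor n) h)) (∣m⇒∣m*n _ P∣D))
      ... | inj₁ P∣n = P∣n
      ... | inj₂ h′  = ⊥-elim (P∤coefficient n h′)

      P∣Lp : P ∣ L p
      P∣Lp with expansion p
      ... | r , eq with ∣-* (factor p) (L p)
              (subst (P ∣_) (sym eq) (∣m∣n⇒∣m+n (∣m⇒∣m*n _ ∣-refl) (∣m⇒∣m*n _ P∣D)))
      ... | inj₁ h = ⊥-elim (P∤factor p h)
      ... | inj₂ h = h

      p≢3 : p ≢ 3
      p≢3 refl = 3∤a²+4 a P∣D

      -- Only the first binomial term survives modulo p²: the rest is D times a bracket, and p
      -- divides D as well as the bracket, in the latter because p ∣ C(p,3). The surviving term is p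
      -- times a unit modulo p.
      P²∤Lp : ¬ P^ 2 ∣ L p
      P²∤Lp h with expansion p
      ... | r , eq = P∤coefficient p (*-cancelˡ-∣ P (∣m+n∣n⇒∣m
          (subst₂ _∣_ P^2 eq (∣n⇒∣m*n (factor p) h))
          (∣-trans (*-monoʳ-∣ P second) (*-monoˡ-∣ _ P∣D))))
        where
        second : P ∣ + 2 * a ^ p * tetrahedral p + D * r
        second = ∣m∣n⇒∣m+n (∣n⇒∣m*n (+ 2 * a ^ p) (P∣tetrahedral p≢3)) (∣m⇒∣m*n r P∣D)

      P²∤Lα : ∀ α → IsRankOfAppearance L p α → ¬ P^ 2 ∣ L α
      P²∤Lα α@(suc _) (_ , P∣Lα , least) = subst (λ n → ¬ P^ 2 ∣ L n)
        (ℕ.≤-antisym (ℕ.∣⇒≤ (∣⇒∣ᵤ (P∣L⇒P∣n α (∣ᵤ⇒∣ P∣Lα))))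
                     (least p (ℕ.≤-trans (s≤s z≤n) 3≤p) (∣⇒∣ᵤ P∣Lp)))
        P²∤Lp

open PrimeArithmetic

-- Rational numbers approximated by quotients of Lucas numbers

module RationalApproximation where
  open Signed
  open import Data.Rational.Base using (_+_; _*_; -_; _-_)
  open Algebra.Properties.Group ℚ.+-0-group using (inverseʳ-unique)
  open import Relation.Binary.PropositionalEquality using (refl; sym; trans; subst; module ≡-Reasoning)

  fromℤ-homo-neg : ∀ x → fromℤ (ℤ.- x) ≡ - fromℤ x
  fromℤ-homo-neg x = inverseʳ-unique (fromℤ x) (fromℤ (ℤ.- x))
    (trans (sym (fromℤ-homo-+ x (ℤ.- x))) (cong fromℤ (ℤ.+-inverseʳ x)))

  fromℤ-homo-minus : ∀ x y → fromℤ (x ℤ.- y) ≡ fromℤ x - fromℤ y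
  fromℤ-homo-minus x y = trans (fromℤ-homo-+ x (ℤ.- y)) (cong (λ z → fromℤ x + z) (fromℤ-homo-neg y))

  fromℤ-cancelʳ : ∀ {x y} c → c ≢ 0ℤ → x * fromℤ c ≡ y * fromℤ c → x ≡ y
  fromℤ-cancelʳ {x} {y} c c≢0 eq = begin
    x                           ≡⟨ ℚ.*-identityʳ x ⟨
    x * 1ℚ                      ≡⟨ cong (x *_) (ℚ.*-inverseʳ (fromℤ c)) ⟨
    x * (fromℤ c * c⁻¹)         ≡⟨ ℚ.*-assoc x (fromℤ c) c⁻¹ ⟨
    x * fromℤ c * c⁻¹           ≡⟨ cong (_* c⁻¹) eq ⟩
    y * fromℤ c * c⁻¹           ≡⟨ ℚ.*-assoc y (fromℤ c) c⁻¹ ⟩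
    y * (fromℤ c * c⁻¹)         ≡⟨ cong (y *_) (ℚ.*-inverseʳ (fromℤ c)) ⟩
    y * 1ℚ                      ≡⟨ ℚ.*-identityʳ y ⟩
    y                           ∎
    where
    open ≡-Reasoning
    instance
      _ = ℚ.≢-nonZero (λ e → c≢0 (fromℤ-injective {c} {0ℤ} e))
    c⁻¹ = ℚ.1/ fromℤ c

  ratio-* : ∀ x y y≢0 → ratio x y y≢0 * fromℤ y ≡ fromℤ x
  ratio-* x y y≢0 = trans (ℚ.*-assoc (fromℤ x) (ℚ.1/ fromℤ y) (fromℤ y))
    (trans (cong (fromℤ x *_) (ℚ.*-inverseˡ (fromℤ y))) (ℚ.*-identityʳ (fromℤ x)))
    where
    instance
      _ = ℚ.≢-nonZero (λ e → y≢0 (fromℤ-injective {y} {0ℤ} e))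

  minus-ratio : ∀ X x y y≢0 →
                (X - ratio x y y≢0) * fromℤ (↧ X ℤ.* y) ≡ fromℤ (↥ X ℤ.* y ℤ.- ↧ X ℤ.* x)
  minus-ratio X x y y≢0 = begin
    (X - r) * fromℤ (↧ X ℤ.* y)
      ≡⟨ cong ((X - r) *_) (fromℤ-homo-* (↧ X) y) ⟩
    (X - r) * (fromℤ (↧ X) * fromℤ y)
      ≡⟨ solve 4 (λ X r d y → (X :- r) :* (d :* y) := X :* d :* y :- d :* (r :* y))
           refl X r (fromℤ (↧ X)) (fromℤ y) ⟩
    X * fromℤ (↧ X) * fromℤ y - fromℤ (↧ X) * (r * fromℤ y)
      ≡⟨ cong₂ (λ s t → s * fromℤ y - fromℤ (↧ X) * t) (*-fromℤ-↧ X) (ratio-* x y y≢0) ⟩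
    fromℤ (↥ X) * fromℤ y - fromℤ (↧ X) * fromℤ x
      ≡⟨ cong₂ _-_ (fromℤ-homo-* (↥ X) y) (fromℤ-homo-* (↧ X) x) ⟨
    fromℤ (↥ X ℤ.* y) - fromℤ (↧ X ℤ.* x)
      ≡⟨ fromℤ-homo-minus (↥ X ℤ.* y) (↧ X ℤ.* x) ⟨
    fromℤ (↥ X ℤ.* y ℤ.- ↧ X ℤ.* x) ∎
    where
    open ≡-Reasoning
    open +-*-Solver
    r = ratio x y y≢0

  minus-integer : ∀ X c → (X - fromℤ c) * fromℤ (↧ X) ≡ fromℤ (↥ X ℤ.- ↧ X ℤ.* c)
  minus-integer X c = begin
    (X - fromℤ c) * fromℤ (↧ X)
      ≡⟨ solve 3 (λ X c d → (X :- c) :* d := X :* d :- d :* c) refl X (fromℤ c) (fromℤ (↧ X)) ⟩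
    X * fromℤ (↧ X) - fromℤ (↧ X) * fromℤ c
      ≡⟨ cong₂ _-_ (sym (*-fromℤ-↧ X)) (fromℤ-homo-* (↧ X) c) ⟨
    fromℤ (↥ X) - fromℤ (↧ X ℤ.* c)
      ≡⟨ fromℤ-homo-minus (↥ X) (↧ X ℤ.* c) ⟨
    fromℤ (↥ X ℤ.- ↧ X ℤ.* c) ∎
    where
    open ≡-Reasoning
    open +-*-Solver

  module RationalAdic (p : ℕ) (p-prime : Prime p) where
    open PrimePowers p p-prime
    open Adic p p-prime

    P^-+ : ∀ j k → P^ (j ℕ.+ k) ≡ P^ j ℤ.* P^ k
    P^-+ j k = trans (cong +_ (ℕ.^-distribˡ-+-* p j k)) (ℤ.pos-* (p ℕ.^ j) (p ℕ.^ k))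

    ≢0-of-∤ : ∀ {z} → ¬ P ∣ z → z ≢ 0ℤ
    ≢0-of-∤ P∤z refl = P∤z (divides 0ℤ refl)

    abstract
      small-introℤ : ∀ {q k} m d → ¬ P ∣ d →
                     q * fromℤ d ≡ fromℤ (m ℤ.* P^ k) → ∣ q ∣≤p^- k
      small-introℤ {q} {k} m (+ n) P∤d eq = small-intro m n (λ h → P∤d (∣ᵤ⇒∣ h)) eq
      small-introℤ {q} {k} m (-[1+ n ]) P∤d eq =
        small-intro (ℤ.- m) (suc n) (λ h → P∤d (∣ᵤ⇒∣ h)) (begin
          q * fromℤ (+ suc n)            ≡⟨ cong (q *_) (fromℤ-homo-neg -[1+ n ]) ⟩
          q * - fromℤ -[1+ n ]           ≡⟨ ℚ.neg-distribʳ-* q (fromℤ -[1+ n ]) ⟨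
          - (q * fromℤ -[1+ n ])         ≡⟨ cong -_ eq ⟩
          - fromℤ (m ℤ.* P^ k)           ≡⟨ fromℤ-homo-neg (m ℤ.* P^ k) ⟨
          fromℤ (ℤ.- (m ℤ.* P^ k))       ≡⟨ cong fromℤ (ℤ.neg-distribˡ-* m (P^ k)) ⟩
          fromℤ (ℤ.- m ℤ.* P^ k)         ∎)
        where open ≡-Reasoning

      -- Here c may be a power of p shared by numerator and denominator, which has to go before the
      -- denominator is prime to p.
      small-intro-cancel : ∀ {q k} c m d → c ≢ 0ℤ → ¬ P ∣ d →
                           q * fromℤ (c ℤ.* d) ≡ fromℤ (c ℤ.* (m ℤ.* P^ k)) → ∣ q ∣≤p^- k
      small-intro-cancel {q} {k} c m d c≢0 P∤d eq = small-introℤ m d P∤d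
        (fromℤ-cancelʳ c c≢0 (begin
          q * fromℤ d * fromℤ c            ≡⟨ ℚ.*-assoc q (fromℤ d) (fromℤ c) ⟩
          q * (fromℤ d * fromℤ c)          ≡⟨ cong (q *_) (fromℤ-homo-* d c) ⟨
          q * fromℤ (d ℤ.* c)              ≡⟨ cong (λ z → q * fromℤ z) (ℤ.*-comm d c) ⟩
          q * fromℤ (c ℤ.* d)              ≡⟨ eq ⟩
          fromℤ (c ℤ.* (m ℤ.* P^ k))       ≡⟨ cong fromℤ (ℤ.*-comm c (m ℤ.* P^ k)) ⟩
          fromℤ (m ℤ.* P^ k ℤ.* c)         ≡⟨ fromℤ-homo-* (m ℤ.* P^ k) c ⟩
          fromℤ (m ℤ.* P^ k) * fromℤ c     ∎))
        where open ≡-Reasoning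

    lowest-terms : ∀ X → P ∣ ↥ X → ¬ P ∣ ↧ X
    lowest-terms (mkℚ _ _ c) hn hd =
      ∤1 (∣ᵤ⇒∣ (ℕ.∣-reflexive (Coprime.recompute c (∣⇒∣ᵤ hn , ∣⇒∣ᵤ hd))))

    ∤↧ : ∀ X c → P ∣ ↥ X ℤ.- ↧ X ℤ.* c → ¬ P ∣ ↧ X
    ∤↧ X c h hd = lowest-terms X (∣m+n∣n⇒∣m h (∣m⇒∣-m (∣m⇒∣m*n c hd))) hd

    abstract
      near-integer : ∀ X c → P ∣ ↥ X ℤ.- ↧ X ℤ.* c → ∣ X - fromℤ c ∣≤p^- 1
      near-integer X c h@(divides m eq) = small-introℤ m (↧ X) (∤↧ X c h)
        (trans (minus-integer X c) (cong fromℤ (trans eq (cong (m ℤ.*_) (sym P^1)))))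

      -- Together with `near-integer` this makes congruence of X to c modulo p a decidable
      -- divisibility, including the case that p divides the denominator of X.
      near-integer⁻¹ : ∀ X c → ∣ X - fromℤ c ∣≤p^- 1 → P ∣ ↥ X ℤ.- ↧ X ℤ.* c
      near-integer⁻¹ X c h =
        let m , d , p∤d , eq = small-elim h
        in [ (λ k → k) , (λ P∣d → ⊥-elim (p∤d (∣⇒∣ᵤ P∣d))) ]′ (∣-* (↥ X ℤ.- ↧ X ℤ.* c) (+ d)
          (divides (m ℤ.* ↧ X) (fromℤ-injective (begin
            fromℤ ((↥ X ℤ.- ↧ X ℤ.* c) ℤ.* + d)
              ≡⟨ fromℤ-homo-* (↥ X ℤ.- ↧ X ℤ.* c) (+ d) ⟩
            fromℤ (↥ X ℤ.- ↧ X ℤ.* c) * fromℤ (+ d)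
              ≡⟨ cong (_* fromℤ (+ d)) (minus-integer X c) ⟨
            (X - fromℤ c) * fromℤ (↧ X) * fromℤ (+ d)
              ≡⟨ solve 3 (λ x y z → x :* y :* z := x :* z :* y)
                   refl (X - fromℤ c) (fromℤ (↧ X)) (fromℤ (+ d)) ⟩
            (X - fromℤ c) * fromℤ (+ d) * fromℤ (↧ X)
              ≡⟨ cong (_* fromℤ (↧ X)) eq ⟩
            fromℤ (m ℤ.* P^ 1) * fromℤ (↧ X)
              ≡⟨ fromℤ-homo-* (m ℤ.* P^ 1) (↧ X) ⟨
            fromℤ (m ℤ.* P^ 1 ℤ.* ↧ X)
              ≡⟨ cong fromℤ (trans (cong (λ z → m ℤ.* z ℤ.* ↧ X) P^1) (lemma m P (↧ X))) ⟩
            fromℤ (m ℤ.* ↧ X ℤ.* P) ∎))))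
        where
        open ≡-Reasoning
        open +-*-Solver
        lemma : ∀ m P d → m ℤ.* P ℤ.* d ≡ m ℤ.* d ℤ.* P
        lemma = solve-∀

  module Density (p : ℕ) (p-prime : Prime p) (3≤p : 3 ≤ p) (a : ℤ) (γ : ℕ)
    (P∣Lα : + p ∣ lucas a 1ℤ (2 ℕ.+ γ)) (P²∤Lα : ¬ + (p ℕ.^ 2) ∣ lucas a 1ℤ (2 ℕ.+ γ))
    (P∤Lγ : ¬ + p ∣ lucas a 1ℤ γ) where

    open PrimePowers p p-prime
    open Adic p p-prime
    open RationalAdic p p-prime
    open OddPrime p p-prime 3≤p
    open Lucas a
    private
      α = 2 ℕ.+ γ
      β = 1 ℕ.+ γ
    open SimpleZero a α P∣Lα P²∤Lα

    Approximable : ℚ → ℕ → ℕ → Set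
    Approximable X k i = ∃ λ n → Σ (L n ≢ 0ℤ) λ Lₙ≢0 → ∣ X - ratio (L (n ℕ.+ i)) (L n) Lₙ≢0 ∣≤p^- k

    -- By the addition formula the numerator of X - Lₙ₊α / Lₙ over the denominator `↧ X * L n` is w
    -- Lₙ - u Lₙ₊₁, which is the `G` of these w and u.
    approximable-α : ∀ X k → ¬ P ∣ ↥ X ℤ.- ↧ X ℤ.* L β → Approximable X k α
    approximable-α X k P∤w =
      let e , d , P∤d , den≡ = factor-P (↧ₙ X)
          c , P∤c , Lα≡ = exact 0
          -- Let p^e be the exact power of p in the denominator of X. From w Lₙ = G n + u Lₙ₊₁, with
          -- u of valuation e + 1, Lₙ has valuation exactly e + 1 once G n is more divisible. The
          -- denominator `↧ X * L n` then has valuation 2e + 1, and precision k is needed on top;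
          -- `approximate` adds one more power of p.
          m , divides g G≡ = approximate (e ℕ.+ (suc e ℕ.+ k))
      in found e d P∤d den≡
           c P∤c (trans (cong L (sym (ℕ.*-identityˡ α))) (trans Lα≡ (cong (ℤ._* c) P^1)))
           (m ℕ.* α) (P∤L-suc (m ℕ.* α) (P∣L-multiple m)) g G≡
      where
      w u : ℤ
      w = ↥ X ℤ.- ↧ X ℤ.* L β
      u = ↧ X ℤ.* L α
      open Approximation w u P∤w (∣n⇒∣m*n (↧ X) P∣Lα)
      module _ (e : ℕ) (d : ℤ) (P∤d : ¬ P ∣ d) (den≡ : ↧ X ≡ P^ e ℤ.* d)
               (c : ℤ) (P∤c : ¬ P ∣ c) (Lα≡ : L α ≡ P ℤ.* c)
               (n : ℕ) (P∤f : ¬ P ∣ L (suc n))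
               (g : ℤ) (G≡ : G n ≡ g ℤ.* P^ suc (e ℕ.+ (suc e ℕ.+ k))) where
        f = L (suc n)
        Q = P^ e
        K = P^ k
        G≡′ : G n ≡ g ℤ.* (P ℤ.* (Q ℤ.* (P ℤ.* Q ℤ.* K)))
        G≡′ = trans G≡ (cong (g ℤ.*_) (trans (P^-suc (e ℕ.+ (suc e ℕ.+ k))) (cong (P ℤ.*_)
                (trans (P^-+ e (suc e ℕ.+ k)) (cong (Q ℤ.*_)
                  (trans (P^-+ (suc e) k) (cong (ℤ._* K) (P^-suc e))))))))
        wL≡ : w ℤ.* L n ≡ (g ℤ.* (P ℤ.* Q ℤ.* K) ℤ.+ d ℤ.* c ℤ.* f) ℤ.* P^ suc e
        wL≡ = begin
          w ℤ.* L n
            ≡⟨ lemma₁ (w ℤ.* L n) (u ℤ.* f) ⟩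
          G n ℤ.+ ↧ X ℤ.* L α ℤ.* f
            ≡⟨ cong₂ ℤ._+_ G≡′ (cong₂ (λ s t → s ℤ.* t ℤ.* f) den≡ Lα≡) ⟩
          g ℤ.* (P ℤ.* (Q ℤ.* (P ℤ.* Q ℤ.* K))) ℤ.+ Q ℤ.* d ℤ.* (P ℤ.* c) ℤ.* f
            ≡⟨ lemma₂ g P Q K d c f ⟩
          (g ℤ.* (P ℤ.* Q ℤ.* K) ℤ.+ d ℤ.* c ℤ.* f) ℤ.* (P ℤ.* Q)
            ≡⟨ cong ((g ℤ.* (P ℤ.* Q ℤ.* K) ℤ.+ d ℤ.* c ℤ.* f) ℤ.*_) (sym (P^-suc e)) ⟩
          (g ℤ.* (P ℤ.* Q ℤ.* K) ℤ.+ d ℤ.* c ℤ.* f) ℤ.* P^ suc e ∎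
          where
          open ≡-Reasoning
          lemma₁ : ∀ x y → x ≡ x ℤ.- y ℤ.+ y
          lemma₁ = solve-∀
          lemma₂ : ∀ g P Q K d c f →
            g ℤ.* (P ℤ.* (Q ℤ.* (P ℤ.* Q ℤ.* K))) ℤ.+ Q ℤ.* d ℤ.* (P ℤ.* c) ℤ.* f
            ≡ (g ℤ.* (P ℤ.* Q ℤ.* K) ℤ.+ d ℤ.* c ℤ.* f) ℤ.* (P ℤ.* Q)
          lemma₂ = solve-∀
        divisible : P^ suc e ∣ L n
        divisible = P^-cancelˡ (suc e) w P∤w
          (divides (g ℤ.* (P ℤ.* Q ℤ.* K) ℤ.+ d ℤ.* c ℤ.* f) wL≡)
        z = quotient divisible
        L≡ : L n ≡ z ℤ.* P^ suc e
        L≡ = _∣_.equality divisible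
        P∤z : ¬ P ∣ z
        P∤z P∣z = ∤-* (∤-* P∤d P∤c) P∤f
          (∣m+n∣m⇒∣n (subst (P ∣_) wz≡ (∣n⇒∣m*n w P∣z))
                     (∣n⇒∣m*n g (∣m⇒∣m*n K (∣m⇒∣m*n Q ∣-refl))))
          where
          wz≡ : w ℤ.* z ≡ g ℤ.* (P ℤ.* Q ℤ.* K) ℤ.+ d ℤ.* c ℤ.* f
          wz≡ = ℤ.*-cancelʳ-≡ (w ℤ.* z) (g ℤ.* (P ℤ.* Q ℤ.* K) ℤ.+ d ℤ.* c ℤ.* f)
            (P^ suc e) {{P^-nonZero (suc e)}}
            (trans (ℤ.*-assoc w z (P^ suc e)) (trans (cong (w ℤ.*_) (sym L≡)) wL≡))
        P^≢0 : ∀ j → P^ j ≢ 0ℤ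
        P^≢0 j eq = ℕ.≢-nonZero⁻¹ (p ℕ.^ j) {{P^-nonZero j}} (ℤ.+-injective eq)
        Ln≢0 : L n ≢ 0ℤ
        Ln≢0 eq = [ ≢0-of-∤ P∤z , P^≢0 (suc e) ]′ (ℤ.i*j≡0⇒i≡0∨j≡0 z (trans (sym L≡) eq))
        -- The full power of p in `↧ X * L n`.
        C = Q ℤ.* P^ suc e
        C≢0 : C ≢ 0ℤ
        C≢0 eq = P^≢0 (e ℕ.+ suc e) (trans (P^-+ e (suc e)) eq)
        found : Approximable X k α
        found = n , Ln≢0 , small-intro-cancel C (g ℤ.* P) (d ℤ.* z) C≢0 (∤-* P∤d P∤z) (begin
          (X - ratio (L (n ℕ.+ α)) (L n) Ln≢0) * fromℤ (C ℤ.* (d ℤ.* z))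
            ≡⟨ cong (λ t → (X - ratio (L (n ℕ.+ α)) (L n) Ln≢0) * fromℤ t)
                 (trans (lemma₃ Q (P^ suc e) d z) (sym (cong₂ ℤ._*_ den≡ L≡))) ⟩
          (X - ratio (L (n ℕ.+ α)) (L n) Ln≢0) * fromℤ (↧ X ℤ.* L n)
            ≡⟨ minus-ratio X (L (n ℕ.+ α)) (L n) Ln≢0 ⟩
          fromℤ (↥ X ℤ.* L n ℤ.- ↧ X ℤ.* L (n ℕ.+ α))
            ≡⟨ cong (λ t → fromℤ (↥ X ℤ.* L n ℤ.- ↧ X ℤ.* t))
                 (trans (cong L (ℕ.+-suc n β)) (L-suc-+ n β)) ⟩
          fromℤ (↥ X ℤ.* L n ℤ.- ↧ X ℤ.* (f ℤ.* L α ℤ.+ L n ℤ.* L β))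
            ≡⟨ cong fromℤ (lemma₄ (↥ X) (↧ X) (L n) f (L α) (L β)) ⟩
          fromℤ (G n)
            ≡⟨ cong fromℤ (trans G≡′ (trans (lemma₅ g P Q K)
                 (cong (λ t → Q ℤ.* t ℤ.* (g ℤ.* P ℤ.* K)) (sym (P^-suc e))))) ⟩
          fromℤ (C ℤ.* (g ℤ.* P ℤ.* K)) ∎)
          where
          open ≡-Reasoning
          lemma₃ : ∀ Q R d z → Q ℤ.* R ℤ.* (d ℤ.* z) ≡ Q ℤ.* d ℤ.* (z ℤ.* R)
          lemma₃ = solve-∀
          lemma₄ : ∀ N D x f A B → N ℤ.* x ℤ.- D ℤ.* (f ℤ.* A ℤ.+ x ℤ.* B)
                                 ≡ (N ℤ.- D ℤ.* B) ℤ.* x ℤ.- D ℤ.* A ℤ.* f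
          lemma₄ = solve-∀
          lemma₅ : ∀ g P Q K → g ℤ.* (P ℤ.* (Q ℤ.* (P ℤ.* Q ℤ.* K)))
                             ≡ Q ℤ.* (P ℤ.* Q) ℤ.* (g ℤ.* P ℤ.* K)
          lemma₅ = solve-∀

    -- The index is n + 1 with α ∣ n. Both Lₙ₊₁ and the denominator of X are prime to p, so the
    -- error has the valuation of G n and no precision is lost.
    approximable-γ : ∀ X k → P ∣ ↥ X ℤ.- ↧ X ℤ.* L β → Approximable X k γ
    approximable-γ X k P∣u =
      let m , divides g G≡ = approximate k
      in found (m ℕ.* α) (P∤L-suc (m ℕ.* α) (P∣L-multiple m)) g G≡
      where
      w u : ℤ
      w = ↧ X ℤ.* L γ
      u = ↥ X ℤ.- ↧ X ℤ.* L β
      P∤den : ¬ P ∣ ↧ X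
      P∤den = ∤↧ X (L β) P∣u
      open Approximation w u (∤-* P∤den P∤Lγ) P∣u
      module _ (n : ℕ) (P∤f : ¬ P ∣ L (suc n)) (g : ℤ) (G≡ : G n ≡ g ℤ.* P^ suc k) where
        f = L (suc n)
        found : Approximable X k γ
        found = suc n , ≢0-of-∤ P∤f , small-introℤ (ℤ.- g ℤ.* P) (↧ X ℤ.* f) (∤-* P∤den P∤f) (begin
          (X - ratio (L (suc (n ℕ.+ γ))) f (≢0-of-∤ P∤f)) * fromℤ (↧ X ℤ.* f)
            ≡⟨ minus-ratio X (L (suc (n ℕ.+ γ))) f (≢0-of-∤ P∤f) ⟩
          fromℤ (↥ X ℤ.* f ℤ.- ↧ X ℤ.* L (suc (n ℕ.+ γ)))
            ≡⟨ cong (λ t → fromℤ (↥ X ℤ.* f ℤ.- ↧ X ℤ.* t)) (L-suc-+ n γ) ⟩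
          fromℤ (↥ X ℤ.* f ℤ.- ↧ X ℤ.* (f ℤ.* L β ℤ.+ L n ℤ.* L γ))
            ≡⟨ cong fromℤ (lemma₁ (↥ X) (↧ X) (L n) f (L β) (L γ)) ⟩
          fromℤ (ℤ.- G n)
            ≡⟨ cong (λ t → fromℤ (ℤ.- t)) (trans G≡ (cong (g ℤ.*_) (P^-suc k))) ⟩
          fromℤ (ℤ.- (g ℤ.* (P ℤ.* P^ k)))
            ≡⟨ cong fromℤ (lemma₂ g P (P^ k)) ⟩
          fromℤ (ℤ.- g ℤ.* P ℤ.* P^ k) ∎)
          where
          open ≡-Reasoning
          lemma₁ : ∀ N D x f B C → N ℤ.* f ℤ.- D ℤ.* (f ℤ.* B ℤ.+ x ℤ.* C)
                                 ≡ ℤ.- (D ℤ.* C ℤ.* x ℤ.- (N ℤ.- D ℤ.* B) ℤ.* f)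
          lemma₁ = solve-∀
          lemma₂ : ∀ g P K → ℤ.- (g ℤ.* (P ℤ.* K)) ≡ ℤ.- g ℤ.* P ℤ.* K
          lemma₂ = solve-∀

    module _ (x : ℚₚ) where
      private
        N₁ : ℕ
        N₁ = proj₁ (cauchy x 1)

        index : ℕ → ℕ
        index k = N₁ ⊔ proj₁ (cauchy x k)

        X : ℕ → ℚ
        X k = seq x (index k)

        -- All approximants are taken beyond N₁, so they agree modulo p with one fixed rational
        -- term. A single decidable test on that term therefore chooses the same shift for every
        -- precision.
        X-near : ∀ k → ∣ X k - seq x N₁ ∣≤p^- 1
        X-near k = proj₂ (cauchy x 1) (index k) N₁ (ℕ.m≤m⊔n N₁ _) ℕ.≤-refl

        closure : ∀ i → (∀ k → Approximable (X k) k i) → Closure (ShiftRatios L i) x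
        closure i approximable k =
          let n , Ln≢0 , h = approximable k
              r = ratio (L (n ℕ.+ i)) (L n) Ln≢0
              M , hx = cauchy x k
          in fromℚ r , (n , Ln≢0 , pointwise {fromℚ r} {fromℚ r} (λ _ → refl))
           , smallₚ (index k , λ j i≤j → diff-trans (seq x j) (X k) r
               (hx j (index k) (ℕ.m⊔n≤o⇒n≤o N₁ M i≤j) (ℕ.m≤n⊔m N₁ M)) h)

      covered : (Closure (ShiftRatios L α) ∪ Closure (ShiftRatios L γ)) x
      covered with P ∣? ↥ (seq x N₁) ℤ.- ↧ (seq x N₁) ℤ.* L β
      ... | yes h = inj₂ (closure γ λ k → approximable-γ (X k) k (near-integer⁻¹ (X k) (L β)
              (diff-trans (X k) (seq x N₁) (fromℤ (L β)) (X-near k) (near-integer (seq x N₁) (L β) h))))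
      ... | no h = inj₁ (closure α λ k → approximable-α (X k) k λ h′ → h (near-integer⁻¹ (seq x N₁) (L β)
              (diff-trans (seq x N₁) (X k) (fromℤ (L β))
                (diff-sym (X k) (seq x N₁) (X-near k)) (near-integer (X k) (L β) h′))))

    covering : Closure (ShiftRatios L α) ∪ Closure (ShiftRatios L γ) ≐ U
    covering = (λ _ → tt) , λ {x} _ → covered x

open RationalApproximation

-- Binet's formula over a commutative ring

module IntegerCoefficients (K : CommutativeRing 0ℓ 0ℓ) where
  open CommutativeRing K

  record IsHomomorphism (ι : ℤ → Carrier) : Set where
    field
      +-homo : ∀ x y → ι (x ℤ.+ y) ≈ ι x + ι y
      *-homo : ∀ x y → ι (x ℤ.* y) ≈ ι x * ι y
      neg-homo : ∀ x → ι (ℤ.- x) ≈ - ι x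
      0-homo : ι 0ℤ ≈ 0#
      1-homo : ι 1ℤ ≈ 1#

  module Solver {ι : ℤ → Carrier} (hom : IsHomomorphism ι) where
    open IsHomomorphism hom

    private
      morphism : ℤ.+-*-rawRing -Raw-AlmostCommutative⟶ fromCommutativeRing K
      morphism = record
        { ⟦_⟧ = ι ; +-homo = +-homo ; *-homo = *-homo
        ; -‿homo = neg-homo ; 0-homo = 0-homo ; 1-homo = 1-homo }

      _≟_ : ∀ x y → Maybe (ι x ≈ ι y)
      x ≟ y with x ℤ.≟ y
      ... | yes x≡y = just (reflexive (cong ι x≡y))
      ... | no _    = nothing

    open RingSolver ℤ.+-*-rawRing (fromCommutativeRing K) morphism _≟_ public
      using (solve; _:+_; _:*_; :-_; _:-_; _:=_; con)

module Binet (K : CommutativeRing 0ℓ 0ℓ)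
  {ι : ℤ → CommutativeRing.Carrier K} (hom : IntegerCoefficients.IsHomomorphism K ι)
  (a : ℤ) (s h : CommutativeRing.Carrier K)
  (s²≈D : CommutativeRing._≈_ K (CommutativeRing._*_ K s s) (ι (a ℤ.* a ℤ.+ + 4)))
  (2h≈1 : CommutativeRing._≈_ K (CommutativeRing._*_ K (ι (+ 2)) h) (CommutativeRing.1# K))
  where
  open CommutativeRing K
  open IntegerCoefficients K
  open IsHomomorphism hom
  open Solver hom
  open Exp semiring
  open Lucas a using (L)
  open import Relation.Binary.Reasoning.Setoid setoid

  λ₁ λ₂ : Carrier
  λ₁ = (ι a + s) * h
  λ₂ = (ι a - s) * h

  λ-sum : λ₁ + λ₂ ≈ ι a
  λ-sum = begin
    λ₁ + λ₂
      ≈⟨ solve 3 (λ a s h → (a :+ s) :* h :+ (a :- s) :* h := a :* (con (+ 2) :* h))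
           refl (ι a) s h ⟩
    ι a * (ι (+ 2) * h) ≈⟨ *-congˡ 2h≈1 ⟩
    ι a * 1#            ≈⟨ *-identityʳ (ι a) ⟩
    ι a                 ∎

  λ-difference : λ₁ - λ₂ ≈ s
  λ-difference = begin
    λ₁ - λ₂
      ≈⟨ solve 3 (λ a s h → (a :+ s) :* h :- (a :- s) :* h := s :* (con (+ 2) :* h))
           refl (ι a) s h ⟩
    s * (ι (+ 2) * h)   ≈⟨ *-congˡ 2h≈1 ⟩
    s * 1#              ≈⟨ *-identityʳ s ⟩
    s                   ∎

  -- The norm of λ₁ is (a² - D) / 4 = -1. Thus -λ₂ is an explicit inverse of λ₁.
  λ-product : λ₁ * - λ₂ ≈ 1#
  λ-product = begin
    λ₁ * - λ₂
      ≈⟨ solve 3 (λ a s h → (a :+ s) :* h :* :- ((a :- s) :* h) := (s :* s :- a :* a) :* h :* h)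
           refl (ι a) s h ⟩
    (s * s - ι a * ι a) * h * h
      ≈⟨ *-congʳ (*-congʳ (+-congʳ (trans s²≈D
           (trans (+-homo (a ℤ.* a) (+ 4)) (+-congʳ (*-homo a a)))))) ⟩
    (ι a * ι a + ι (+ 4) - ι a * ι a) * h * h
      ≈⟨ solve 2 (λ a h → (a :* a :+ con (+ 4) :- a :* a) :* h :* h := (con (+ 2) :* h) :* (con (+ 2) :* h))
           refl (ι a) h ⟩
    (ι (+ 2) * h) * (ι (+ 2) * h)
      ≈⟨ *-cong 2h≈1 2h≈1 ⟩
    1# * 1#
      ≈⟨ *-identityˡ 1# ⟩
    1# ∎

  module _ (x y : Carrier) (sum : x + y ≈ ι a) (product : x * - y ≈ 1#) where
    -- The two assumptions say that x² = a x + 1. Subtracting the instances for both roots gives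
    -- Binet's formula without dividing by √D.
    root-power : ∀ n → x ^ suc n ≈ ι (L (suc n)) * x + ι (L n)
    root-power zero = begin
      x * 1#             ≈⟨ *-congˡ 1-homo ⟨
      x * ι 1ℤ           ≈⟨ solve 1 (λ x → x :* con 1ℤ := con 1ℤ :* x :+ con 0ℤ) refl x ⟩
      ι 1ℤ * x + ι 0ℤ    ∎
    root-power (suc n) = begin
      x * x ^ suc n
        ≈⟨ *-congˡ (root-power n) ⟩
      x * (ι (L (suc n)) * x + ι (L n))
        ≈⟨ solve 4 (λ x y F G → x :* (F :* x :+ G) := (F :* (x :+ y) :+ G) :* x :+ F :* (x :* :- y))
             refl x y (ι (L (suc n))) (ι (L n)) ⟩
      (ι (L (suc n)) * (x + y) + ι (L n)) * x + ι (L (suc n)) * (x * - y)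
        ≈⟨ +-cong (*-congʳ (+-congʳ (*-congˡ sum))) (trans (*-congˡ product) (*-identityʳ _)) ⟩
      (ι (L (suc n)) * ι a + ι (L n)) * x + ι (L (suc n))
        ≈⟨ +-congʳ (*-congʳ recurrence) ⟨
      ι (L (suc (suc n))) * x + ι (L (suc n)) ∎
      where
      recurrence : ι (L (suc (suc n))) ≈ ι (L (suc n)) * ι a + ι (L n)
      recurrence = begin
        ι (a ℤ.* L (suc n) ℤ.+ 1ℤ ℤ.* L n)       ≈⟨ +-homo _ _ ⟩
        ι (a ℤ.* L (suc n)) + ι (1ℤ ℤ.* L n)     ≈⟨ +-cong (*-homo a (L (suc n))) (*-homo 1ℤ (L n)) ⟩
        ι a * ι (L (suc n)) + ι 1ℤ * ι (L n)
          ≈⟨ solve 3 (λ a F G → a :* F :+ con 1ℤ :* G := F :* a :+ G)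
               refl (ι a) (ι (L (suc n))) (ι (L n)) ⟩
        ι (L (suc n)) * ι a + ι (L n)            ∎

  binet : ∀ n → λ₁ ^ n - λ₂ ^ n ≈ ι (L n) * s
  binet zero = begin
    1# - 1#      ≈⟨ -‿inverseʳ 1# ⟩
    0#           ≈⟨ zeroˡ s ⟨
    0# * s       ≈⟨ *-congʳ 0-homo ⟨
    ι 0ℤ * s     ∎
  binet (suc n) = begin
    λ₁ ^ suc n - λ₂ ^ suc n
      ≈⟨ +-cong (root-power λ₁ λ₂ λ-sum λ-product n)
           (-‿cong (root-power λ₂ λ₁ (trans (+-comm λ₂ λ₁) λ-sum) product′ n)) ⟩
    ι (L (suc n)) * λ₁ + ι (L n) - (ι (L (suc n)) * λ₂ + ι (L n))
      ≈⟨ solve 4 (λ F G x y → F :* x :+ G :- (F :* y :+ G) := F :* (x :- y))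
           refl (ι (L (suc n))) (ι (L n)) λ₁ λ₂ ⟩
    ι (L (suc n)) * (λ₁ - λ₂)
      ≈⟨ *-congˡ λ-difference ⟩
    ι (L (suc n)) * s ∎
    where
    product′ : λ₂ * - λ₁ ≈ 1#
    product′ = trans (solve 2 (λ x y → y :* :- x := x :* :- y) refl λ₁ λ₂) λ-product

  *-^ : ∀ x y n → (x * y) ^ n ≈ x ^ n * y ^ n
  *-^ x y zero    = sym (*-identityˡ 1#)
  *-^ x y (suc n) = trans (*-congˡ (*-^ x y n))
    (solve 4 (λ x y X Y → x :* y :* (X :* Y) := x :* X :* (y :* Y)) refl x y (x ^ n) (y ^ n))

  1^ : ∀ n → 1# ^ n ≈ 1#
  1^ zero    = refl
  1^ (suc n) = trans (*-identityˡ _) (1^ n)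

  module _ (u : Carrier) (uλ₁≈λ₂ : u * λ₁ ≈ λ₂) where

    quotient-power-* : ∀ n → (u ^ n - 1#) * λ₁ ^ n ≈ ι (L n) * - s
    quotient-power-* n = begin
      (u ^ n - 1#) * λ₁ ^ n
        ≈⟨ *-congʳ (+-congˡ (-‿cong 1-homo)) ⟨
      (u ^ n - ι 1ℤ) * λ₁ ^ n
        ≈⟨ solve 2 (λ x y → (x :- con 1ℤ) :* y := :- (y :- x :* y)) refl (u ^ n) (λ₁ ^ n) ⟩
      - (λ₁ ^ n - u ^ n * λ₁ ^ n)
        ≈⟨ -‿cong (+-congˡ (-‿cong (trans (sym (*-^ u λ₁ n)) (^-congˡ n uλ₁≈λ₂)))) ⟩
      - (λ₁ ^ n - λ₂ ^ n)
        ≈⟨ -‿cong (binet n) ⟩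
      - (ι (L n) * s)
        ≈⟨ solve 2 (λ F s → :- (F :* s) := F :* :- s) refl (ι (L n)) s ⟩
      ι (L n) * - s ∎

    -- Multiplying `quotient-power-*` by the inverse (-λ₂)ⁿ of λ₁ⁿ isolates uⁿ - 1. This form passes
    -- divisibility from Lₙ to uⁿ - 1; the other one is used for the way back.
    quotient-power : ∀ n → u ^ n - 1# ≈ ι (L n) * (- s * (- λ₂) ^ n)
    quotient-power n = begin
      u ^ n - 1#                               ≈⟨ *-identityʳ _ ⟨
      (u ^ n - 1#) * 1#                        ≈⟨ *-congˡ inverse-power ⟨
      (u ^ n - 1#) * (λ₁ ^ n * (- λ₂) ^ n)     ≈⟨ *-assoc _ _ _ ⟨
      (u ^ n - 1#) * λ₁ ^ n * (- λ₂) ^ n       ≈⟨ *-congʳ (quotient-power-* n) ⟩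
      ι (L n) * - s * (- λ₂) ^ n               ≈⟨ *-assoc _ _ _ ⟩
      ι (L n) * (- s * (- λ₂) ^ n)             ∎
      where
      inverse-power : λ₁ ^ n * (- λ₂) ^ n ≈ 1#
      inverse-power = trans (sym (*-^ λ₁ (- λ₂) n)) (trans (^-congˡ n λ-product) (1^ n))

-- Cancellation for the p-adic absolute value

module SmallRationals (p : ℕ) (p-prime : Prime p) where
  open Signed
  open PrimePowers p p-prime
  open Adic p p-prime
  open RationalAdic p p-prime
  open import Data.Rational.Base using (_+_; _*_; -_; _-_)
  open import Relation.Binary.PropositionalEquality using (refl; sym; trans; subst; module ≡-Reasoning)

  abstract
    small-fromℤ : ∀ {k z} → P^ k ∣ z → ∣ fromℤ z ∣≤p^- k
    small-fromℤ {k} {z} (divides m eq) =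
      small-introℤ {fromℤ z} {k} m 1ℤ ∤1 (trans (ℚ.*-identityʳ (fromℤ z)) (cong fromℤ eq))

    small-cancel-unit : ∀ {q k} c → ¬ P ∣ c → ∣ fromℤ c * q ∣≤p^- k → ∣ q ∣≤p^- k
    small-cancel-unit {q} {k} c P∤c h =
      let m , d , p∤d , eq = small-elim {fromℤ c * q} {k} h
      in small-introℤ {q} {k} m (c ℤ.* + d) (∤-* {c} {+ d} P∤c (λ h → p∤d (∣⇒∣ᵤ {P} {+ d} h))) (begin
        q * fromℤ (c ℤ.* + d)          ≡⟨ cong (q *_) (fromℤ-homo-* c (+ d)) ⟩
        q * (fromℤ c * fromℤ (+ d))
          ≡⟨ solve 3 (λ q c d → q :* (c :* d) := c :* q :* d)
               refl q (fromℤ c) (fromℤ (+ d)) ⟩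
        fromℤ c * q * fromℤ (+ d)      ≡⟨ eq ⟩
        fromℤ (m ℤ.* P^ k)             ∎)
      where
      open ≡-Reasoning
      open +-*-Solver

    small-cancel-P : ∀ {q k} → ∣ fromℤ P * q ∣≤p^- suc k → ∣ q ∣≤p^- k
    small-cancel-P {q} {k} h =
      let m , d , p∤d , eq = small-elim {fromℤ P * q} {suc k} h
      in small-intro-cancel {q} {k} P m (+ d) (λ P≡0 → ℕ.≢-nonZero⁻¹ p (ℤ.+-injective P≡0))
           (λ P∣d → p∤d (∣⇒∣ᵤ {P} {+ d} P∣d)) (begin
        q * fromℤ (P ℤ.* + d)          ≡⟨ cong (q *_) (fromℤ-homo-* P (+ d)) ⟩
        q * (fromℤ P * fromℤ (+ d))
          ≡⟨ solve 3 (λ q c d → q :* (c :* d) := c :* q :* d)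
               refl q (fromℤ P) (fromℤ (+ d)) ⟩
        fromℤ P * q * fromℤ (+ d)      ≡⟨ eq ⟩
        fromℤ (m ℤ.* P^ suc k)         ≡⟨ cong (λ z → fromℤ (m ℤ.* z)) (P^-suc k) ⟩
        fromℤ (m ℤ.* (P ℤ.* P^ k))     ≡⟨ cong fromℤ (lemma m P (P^ k)) ⟩
        fromℤ (P ℤ.* (m ℤ.* P^ k))     ∎)
      where
      open ≡-Reasoning
      open +-*-Solver
      lemma : ∀ m P K → m ℤ.* (P ℤ.* K) ≡ P ℤ.* (m ℤ.* K)
      lemma = solve-∀

    -- Valuations are integers. For q = n / e in lowest terms the hypothesis reads n² d = m e² p
    -- with p ∤ d, so p divides n.
    small-sqrt : ∀ {q} → ∣ q * q ∣≤p^- 1 → ∣ q ∣≤p^- 1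
    small-sqrt {q} h =
      let m , d , p∤d , eq = small-elim {q * q} {1} h
          P∣n = numerator m d p∤d eq
      in small (∣⇒∣ᵤ {P^ 1} {↥ q} (subst (_∣ ↥ q) (sym P^1) P∣n))
               (λ P∣e → lowest-terms q P∣n (∣ᵤ⇒∣ {P} {↧ q} P∣e))
      where
      open ≡-Reasoning
      open +-*-Solver
      lemma : ∀ m P e → m ℤ.* P ℤ.* (e ℤ.* e) ≡ m ℤ.* e ℤ.* e ℤ.* P
      lemma = solve-∀
      numerator : ∀ m d → ¬ p ℕ.∣ d → q * q * fromℤ (+ d) ≡ fromℤ (m ℤ.* P^ 1) → P ∣ ↥ q
      numerator m d p∤d eq =
        [ (λ P∣n² → [ (λ P∣n → P∣n) , (λ P∣n → P∣n) ]′ (∣-* (↥ q) (↥ q) P∣n²))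
        , (λ P∣d → ⊥-elim (p∤d (∣⇒∣ᵤ {P} {+ d} P∣d))) ]′
        (∣-* (↥ q ℤ.* ↥ q) (+ d) (divides (m ℤ.* ↧ q ℤ.* ↧ q) (fromℤ-injective (begin
        fromℤ (↥ q ℤ.* ↥ q ℤ.* + d)
          ≡⟨ trans (fromℤ-homo-* (↥ q ℤ.* ↥ q) (+ d))
               (cong (_* fromℤ (+ d)) (fromℤ-homo-* (↥ q) (↥ q))) ⟩
        fromℤ (↥ q) * fromℤ (↥ q) * fromℤ (+ d)
          ≡⟨ cong (λ z → z * z * fromℤ (+ d)) (sym (*-fromℤ-↧ q)) ⟩
        (q * fromℤ (↧ q)) * (q * fromℤ (↧ q)) * fromℤ (+ d)
          ≡⟨ solve 3 (λ q e d → (q :* e) :* (q :* e) :* d := q :* q :* d :* (e :* e))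
               refl q (fromℤ (↧ q)) (fromℤ (+ d)) ⟩
        q * q * fromℤ (+ d) * (fromℤ (↧ q) * fromℤ (↧ q))
          ≡⟨ cong₂ _*_ eq (sym (fromℤ-homo-* (↧ q) (↧ q))) ⟩
        fromℤ (m ℤ.* P^ 1) * fromℤ (↧ q ℤ.* ↧ q)
          ≡⟨ sym (fromℤ-homo-* (m ℤ.* P^ 1) (↧ q ℤ.* ↧ q)) ⟩
        fromℤ (m ℤ.* P^ 1 ℤ.* (↧ q ℤ.* ↧ q))
          ≡⟨ cong fromℤ (trans (cong (λ z → m ℤ.* z ℤ.* (↧ q ℤ.* ↧ q)) P^1) (lemma m P (↧ q))) ⟩
        fromℤ (m ℤ.* ↧ q ℤ.* ↧ q ℤ.* P) ∎))))

    1-not-small : ¬ ∣ 1ℚ ∣≤p^- 1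
    1-not-small (small h _) = ∤1 (subst (_∣ 1ℤ) P^1 (∣ᵤ⇒∣ h))

module SmallAdics (p : ℕ) (p-prime : Prime p) where
  open Signed
  open PrimePowers p p-prime
  open Adic p p-prime
  open SmallRationals p p-prime
  open import Data.Rational.Base using (_+_; _*_; -_; _-_)
  open import Relation.Binary.PropositionalEquality using (refl; sym; trans; subst; module ≡-Reasoning)

  ιₚ : ℤ → ℚₚ
  ιₚ z = fromℚ (fromℤ z)

  abstract
    smallₚ-map : ∀ {x y j k} → (∀ n → ∣ seq x n ∣≤p^- j → ∣ seq y n ∣≤p^- k) →
                 ∣ x ∣ₚ≤p^- j → ∣ y ∣ₚ≤p^- k
    smallₚ-map f (smallₚ (N , h)) = smallₚ (N , λ n N≤n → f n (h n N≤n))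

    smallₚ-map₂ : ∀ {x y z i j k} →
                  (∀ n → ∣ seq x n ∣≤p^- i → ∣ seq y n ∣≤p^- j → ∣ seq z n ∣≤p^- k) →
                  ∣ x ∣ₚ≤p^- i → ∣ y ∣ₚ≤p^- j → ∣ z ∣ₚ≤p^- k
    smallₚ-map₂ f (smallₚ (M , g)) (smallₚ (N , h)) = smallₚ
      (M ⊔ N , λ n le → f n (g n (ℕ.m⊔n≤o⇒m≤o M N le)) (h n (ℕ.m⊔n≤o⇒n≤o M N le)))

    smallₚ-fromℚ : ∀ {q k} → ∣ q ∣≤p^- k → ∣ fromℚ q ∣ₚ≤p^- k
    smallₚ-fromℚ h = smallₚ (0 , λ _ _ → h)

    smallₚ-+ : ∀ {x y k} → ∣ x ∣ₚ≤p^- k → ∣ y ∣ₚ≤p^- k → ∣ x +ₚ y ∣ₚ≤p^- k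
    smallₚ-+ {x} {y} {k} = smallₚ-map₂ {x} {y} {x +ₚ y} (λ n → small-+ {seq x n} {seq y n} {k})

    smallₚ-neg : ∀ {x k} → ∣ x ∣ₚ≤p^- k → ∣ -ₚ x ∣ₚ≤p^- k
    smallₚ-neg {x} {k} = smallₚ-map {x} { -ₚ x} (λ n → small-neg {seq x n} {k})

    smallₚ-* : ∀ {x y j k} → ∣ x ∣ₚ≤p^- j → ∣ y ∣ₚ≤p^- k → ∣ x *ₚ y ∣ₚ≤p^- (j ℕ.+ k)
    smallₚ-* {x} {y} {j} {k} = smallₚ-map₂ {x} {y} {x *ₚ y} (λ n → small-* {seq x n} {seq y n} {j} {k})

    smallₚ-resp : ∀ {x y k} → x ≈ₚ y → ∣ x ∣ₚ≤p^- k → ∣ y ∣ₚ≤p^- k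
    smallₚ-resp {x} {y} {k} e h = smallₚ-map₂ {x} {x +ₚ -ₚ y} {y}
      (λ n hx hd → subst (∣_∣≤p^- k)
        (solve 2 (λ x y → x :+ :- (x :- y) := y) refl (seq x n) (seq y n))
        (small-+ {seq x n} { - (seq x n - seq y n)} {k} hx (small-neg {seq x n - seq y n} {k} hd)))
      h (close e k)
      where open +-*-Solver

    smallₚ-ι : ∀ {k z} → P^ k ∣ z → ∣ ιₚ z ∣ₚ≤p^- k
    smallₚ-ι h = smallₚ-fromℚ (small-fromℤ h)

    smallₚ-ι₀ : ∀ z → ∣ ιₚ z ∣ₚ≤p^- 0
    smallₚ-ι₀ z = smallₚ-ι (divides z (sym (ℤ.*-identityʳ z)))

    smallₚ-cancel-unit : ∀ {x k} c → ¬ P ∣ c → ∣ ιₚ c *ₚ x ∣ₚ≤p^- k → ∣ x ∣ₚ≤p^- k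
    smallₚ-cancel-unit {x} {k} c P∤c =
      smallₚ-map {ιₚ c *ₚ x} {x} (λ n → small-cancel-unit {seq x n} {k} c P∤c)

    smallₚ-cancel-P : ∀ {x k} → ∣ ιₚ P *ₚ x ∣ₚ≤p^- suc k → ∣ x ∣ₚ≤p^- k
    smallₚ-cancel-P {x} {k} = smallₚ-map {ιₚ P *ₚ x} {x} (λ n → small-cancel-P {seq x n} {k})

    smallₚ-sqrt : ∀ {x} → ∣ x *ₚ x ∣ₚ≤p^- 1 → ∣ x ∣ₚ≤p^- 1
    smallₚ-sqrt {x} = smallₚ-map {x *ₚ x} {x} (λ n → small-sqrt {seq x n})

    smallₚ-bounded : ∀ x → ∃ λ e → ∣ ιₚ (P^ e) *ₚ x ∣ₚ≤p^- 0
    smallₚ-bounded x =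
      let e , N , b = eventually-bounded (seq x) (cauchy x)
      in e , smallₚ (N , λ n N≤n → subst (∣_∣≤p^- 0) (ℚ.*-comm (seq x n) (fromℤ (P^ e)))
           (b n N≤n {0} {fromℤ (P^ e)} (subst (∣ fromℤ (P^ e) ∣≤p^-_) (sym (ℕ.+-identityʳ e))
             (small-fromℤ ∣-refl))))

    1-not-smallₚ : ¬ ∣ fromℚ 1ℚ ∣ₚ≤p^- 1
    1-not-smallₚ (smallₚ (N , h)) = 1-not-small (h N ℕ.≤-refl)

module EmbeddingIsHomomorphism (p : ℕ) (p-prime : Prime p) where
  open Adic p p-prime
  open SmallAdics p p-prime
  private
    module R = CommutativeRing ℚₚ-commutativeRing

  ι : ∀ {D} (r : SquareRoot D) → ℤ → CommutativeRing.Carrier (ℚₚ⟨√⟩ r)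
  ι r z = embed r (ιₚ z)

  abstract
    embed-cong : ∀ {D} (r : SquareRoot D) {x y} → x ≈ₚ y →
                 CommutativeRing._≈_ (ℚₚ⟨√⟩ r) (embed r x) (embed r y)
    embed-cong (inside _ _) e = e
    embed-cong (outside _)  e = e , R.refl {fromℚ 0ℚ}

    embed-+ : ∀ {D} (r : SquareRoot D) x y → let open CommutativeRing (ℚₚ⟨√⟩ r) in
              embed r (x +ₚ y) ≈ embed r x + embed r y
    embed-+ (inside _ _) x y = R.refl {x +ₚ y}
    embed-+ (outside _)  x y = R.refl {x +ₚ y}
      , R.sym {fromℚ 0ℚ +ₚ fromℚ 0ℚ} {fromℚ 0ℚ} (R.+-identityˡ (fromℚ 0ℚ))

    embed-* : ∀ {D} (r : SquareRoot D) x y → let open CommutativeRing (ℚₚ⟨√⟩ r) in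
              embed r (x *ₚ y) ≈ embed r x * embed r y
    embed-* (inside _ _) x y = R.refl {x *ₚ y}
    embed-* {D} (outside _)  x y =
        solve 3 (λ d x y → x :* y := x :* y :+ d :* (con 0 :* con 0)) R.refl (fromℚ (fromℤ D)) x y
      , solve 2 (λ x y → con 0 := x :* con 0 :+ con 0 :* y) R.refl x y
      where open NatSolver R.commutativeSemiring

    embed-neg : ∀ {D} (r : SquareRoot D) x → let open CommutativeRing (ℚₚ⟨√⟩ r) in
                embed r (-ₚ x) ≈ - embed r x
    embed-neg (inside _ _) x = R.refl { -ₚ x}
    embed-neg (outside _)  x = R.refl { -ₚ x} , pointwise {fromℚ 0ℚ} { -ₚ fromℚ 0ℚ} (λ _ → ≡.refl)

    embed-0 : ∀ {D} (r : SquareRoot D) → let open CommutativeRing (ℚₚ⟨√⟩ r) in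
              embed r (fromℚ 0ℚ) ≈ 0#
    embed-0 (inside _ _) = R.refl {fromℚ 0ℚ}
    embed-0 (outside _)  = R.refl {fromℚ 0ℚ} , R.refl {fromℚ 0ℚ}

    embed-1 : ∀ {D} (r : SquareRoot D) → let open CommutativeRing (ℚₚ⟨√⟩ r) in
              embed r (fromℚ 1ℚ) ≈ 1#
    embed-1 (inside _ _) = R.refl {fromℚ 1ℚ}
    embed-1 (outside _)  = R.refl {fromℚ 1ℚ} , R.refl {fromℚ 0ℚ}

    ι-homo : ∀ {D} (r : SquareRoot D) → IntegerCoefficients.IsHomomorphism (ℚₚ⟨√⟩ r) (ι r)
    ι-homo r = record
      { +-homo = λ x y → K.trans
          (embed-cong r (pointwise {ιₚ (x ℤ.+ y)} {ιₚ x +ₚ ιₚ y} λ _ → fromℤ-homo-+ x y))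
          (embed-+ r (ιₚ x) (ιₚ y))
      ; *-homo = λ x y → K.trans
          (embed-cong r (pointwise {ιₚ (x ℤ.* y)} {ιₚ x *ₚ ιₚ y} λ _ → fromℤ-homo-* x y))
          (embed-* r (ιₚ x) (ιₚ y))
      ; neg-homo = λ x → K.trans
          (embed-cong r (pointwise {ιₚ (ℤ.- x)} { -ₚ ιₚ x} λ _ → fromℤ-homo-neg x))
          (embed-neg r (ιₚ x))
      ; 0-homo = embed-0 r
      ; 1-homo = embed-1 r }
      where module K = CommutativeRing (ℚₚ⟨√⟩ r)

    2*½≈1 : ∀ {D} (r : SquareRoot D) → let open CommutativeRing (ℚₚ⟨√⟩ r) in
            ι r (+ 2) * embed r (fromℚ ½) ≈ 1#
    2*½≈1 r = K.trans (K.sym (embed-* r (ιₚ (+ 2)) (fromℚ ½)))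
      (K.trans (embed-cong r (pointwise {ιₚ (+ 2) *ₚ fromℚ ½} {fromℚ 1ℚ} λ _ → ≡.refl)) (embed-1 r))
      where module K = CommutativeRing (ℚₚ⟨√⟩ r)

-- The ring of integers of ℚₚ(√D) for p not dividing 2D

module Lattices (p : ℕ) (p-prime : Prime p) where
  open Signed
  open PrimePowers p p-prime
  open Adic p p-prime
  open SmallAdics p p-prime
  open EmbeddingIsHomomorphism p p-prime

  -- V k stands for pᵏ O, where O will turn out to be the ring of integers.
  record Lattice {D : ℤ} (r : SquareRoot D) : Set₁ where
    open CommutativeRing (ℚₚ⟨√⟩ r)
    field
      V : ℕ → Carrier → Set
      V-resp : ∀ {k x y} → x ≈ y → V k x → V k y
      V-+ : ∀ {k x y} → V k x → V k y → V k (x + y)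
      V-* : ∀ {j k x y} → V j x → V k y → V (j ℕ.+ k) (x * y)
      V-embed : ∀ {k c} → ∣ c ∣ₚ≤p^- k → V k (embed r c)
      V-cancel : ∀ {k z} → V (suc k) (ι r P * z) → V k z
      V-bounded : ∀ z → ∃ λ e → V 0 (ι r (P^ e) * z)
      V-sqrt : ∀ {z} → V 0 z → V 1 (z * z) → V 1 z
      1∉V₁ : ¬ V 1 1#
      V⇒Integral : ∀ {z} → V 0 z → QuadraticField.Integral r z

  abstract
    inside-integral : ∀ {D s} (s² : s *ₚ s ≈ₚ fromℚ (fromℤ D)) {z} →
                      ∣ z ∣ₚ≤p^- 0 → QuadraticField.Integral (inside {D} s s²) z
    inside-integral s² {z} h = (-ₚ z ∷ []) , smallₚ-neg {z} h ∷ []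
      , pointwise { -ₚ z +ₚ z *ₚ fromℚ 1ℚ} {fromℚ 0ℚ}
          (λ n → solve 1 (λ x → :- x :+ x :* con 1ℚ := con 0ℚ) ≡.refl (seq z n))
      where open +-*-Solver

  insideLattice : ∀ {D} s (s² : s *ₚ s ≈ₚ fromℚ (fromℤ D)) → Lattice (inside {D} s s²)
  insideLattice {D} s s² = record
    { V = λ k z → ∣ z ∣ₚ≤p^- k
    ; V-resp = λ {k} {x} {y} → smallₚ-resp {x} {y} {k}
    ; V-+ = λ {k} {x} {y} → smallₚ-+ {x} {y} {k}
    ; V-* = λ {j} {k} {x} {y} → smallₚ-* {x} {y} {j} {k}
    ; V-embed = λ h → h
    ; V-cancel = λ {k} {z} → smallₚ-cancel-P {z} {k}
    ; V-bounded = smallₚ-bounded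
    ; V-sqrt = λ {z} _ → smallₚ-sqrt {z}
    ; 1∉V₁ = 1-not-smallₚ
    ; V⇒Integral = λ {z} → inside-integral {D} {s} s² {z} }

  module Outside {D : ℤ} (P∤D : ¬ P ∣ D) (D≢□ : ∀ s → ¬ (s *ₚ s ≈ₚ fromℚ (fromℤ D))) where
    private
      r : SquareRoot D
      r = outside D≢□
      Δ : ℚₚ
      Δ = fromℚ (fromℤ D)
      open CommutativeRing (ℚₚ⟨√⟩ r) using (Carrier; _*_)

    W : ℕ → Carrier → Set
    W k (x , y) = ∣ x ∣ₚ≤p^- k × ∣ y ∣ₚ≤p^- k

    abstract
      -- z = x + y√D is a root of Z² − 2xZ + (x² − Dy²).
      outside-integral : ∀ z → W 0 z → QuadraticField.Integral r z
      outside-integral (x , y) (hx , hy) =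
          (N ∷ T ∷ [])
        , smallₚ-+ {x *ₚ x} { -ₚ (Δ *ₚ (y *ₚ y))} {0} (smallₚ-* {x} {x} {0} {0} hx hx)
            (smallₚ-neg {Δ *ₚ (y *ₚ y)} {0} (smallₚ-* {Δ} {y *ₚ y} {0} {0} (smallₚ-ι₀ D)
              (smallₚ-* {y} {y} {0} {0} hy hy)))
          ∷ smallₚ-neg {x +ₚ x} {0} (smallₚ-+ {x} {x} {0} hx hx) ∷ []
        , pointwise {N +ₚ (x *ₚ A +ₚ Δ *ₚ (y *ₚ B))} {fromℚ 0ℚ}
            (λ n → solve 3 (λ x y d →
                (x :* x :+ :- (d :* (y :* y)))
                  :+ (x :* (:- (x :+ x) :+ (x :* con 1ℚ :+ d :* (y :* con 0ℚ)))
                    :+ d :* (y :* (con 0ℚ :+ (x :* con 0ℚ :+ y :* con 1ℚ))))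
                := con 0ℚ) ≡.refl (seq x n) (seq y n) (fromℤ D))
        , pointwise {fromℚ 0ℚ +ₚ (x *ₚ B +ₚ y *ₚ A)} {fromℚ 0ℚ}
            (λ n → solve 3 (λ x y d →
                con 0ℚ :+ (x :* (con 0ℚ :+ (x :* con 0ℚ :+ y :* con 1ℚ))
                  :+ y :* (:- (x :+ x) :+ (x :* con 1ℚ :+ d :* (y :* con 0ℚ))))
                := con 0ℚ) ≡.refl (seq x n) (seq y n) (fromℤ D))
        where
        open +-*-Solver
        -- N and -T are the norm and the trace of z; (A , B) is the inner Horner value T + z of
        -- `monic`.
        N T A B : ℚₚ
        N = x *ₚ x +ₚ -ₚ (Δ *ₚ (y *ₚ y))
        T = -ₚ (x +ₚ x)
        A = T +ₚ (x *ₚ fromℚ 1ℚ +ₚ Δ *ₚ (y *ₚ fromℚ 0ℚ))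
        B = fromℚ 0ℚ +ₚ (x *ₚ fromℚ 0ℚ +ₚ y *ₚ fromℚ 1ℚ)

      W-* : ∀ {j k} x y → W j x → W k y → W (j ℕ.+ k) (x * y)
      W-* {j} {k} (x , y) (x′ , y′) (hx , hy) (hx′ , hy′) =
          smallₚ-+ {x *ₚ x′} {Δ *ₚ (y *ₚ y′)} {j ℕ.+ k} (smallₚ-* {x} {x′} {j} {k} hx hx′)
            (smallₚ-* {Δ} {y *ₚ y′} {0} {j ℕ.+ k} (smallₚ-ι₀ D) (smallₚ-* {y} {y′} {j} {k} hy hy′))
        , smallₚ-+ {x *ₚ y′} {y *ₚ x′} {j ℕ.+ k} (smallₚ-* {x} {y′} {j} {k} hx hy′)
            (smallₚ-* {y} {x′} {j} {k} hy hx′)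

      scale : ∀ c x y k → W k (ι r c * (x , y)) → ∣ ιₚ c *ₚ x ∣ₚ≤p^- k × ∣ ιₚ c *ₚ y ∣ₚ≤p^- k
      scale c x y k (h , h′) =
          smallₚ-resp {ιₚ c *ₚ x +ₚ Δ *ₚ (fromℚ 0ℚ *ₚ y)} {ιₚ c *ₚ x} {k}
            (pointwise {ιₚ c *ₚ x +ₚ Δ *ₚ (fromℚ 0ℚ *ₚ y)} {ιₚ c *ₚ x}
              (λ n → solve 4 (λ c x y d → c :* x :+ d :* (con 0ℚ :* y) := c :* x)
                ≡.refl (fromℤ c) (seq x n) (seq y n) (fromℤ D))) h
        , smallₚ-resp {ιₚ c *ₚ y +ₚ fromℚ 0ℚ *ₚ x} {ιₚ c *ₚ y} {k}
            (pointwise {ιₚ c *ₚ y +ₚ fromℚ 0ℚ *ₚ x} {ιₚ c *ₚ y}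
              (λ n → solve 3 (λ c x y → c :* y :+ con 0ℚ :* x := c :* y)
                ≡.refl (fromℤ c) (seq x n) (seq y n))) h′
        where open +-*-Solver

      unscale : ∀ c x y k → ∣ ιₚ c *ₚ x ∣ₚ≤p^- k → ∣ ιₚ c *ₚ y ∣ₚ≤p^- k → W k (ι r c * (x , y))
      unscale c x y k h h′ =
          smallₚ-resp {ιₚ c *ₚ x} {ιₚ c *ₚ x +ₚ Δ *ₚ (fromℚ 0ℚ *ₚ y)} {k}
            (pointwise {ιₚ c *ₚ x} {ιₚ c *ₚ x +ₚ Δ *ₚ (fromℚ 0ℚ *ₚ y)}
              (λ n → solve 4 (λ c x y d → c :* x := c :* x :+ d :* (con 0ℚ :* y))
                ≡.refl (fromℤ c) (seq x n) (seq y n) (fromℤ D))) h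
        , smallₚ-resp {ιₚ c *ₚ y} {ιₚ c *ₚ y +ₚ fromℚ 0ℚ *ₚ x} {k}
            (pointwise {ιₚ c *ₚ y} {ιₚ c *ₚ y +ₚ fromℚ 0ℚ *ₚ x}
              (λ n → solve 3 (λ c x y → c :* y := c :* y :+ con 0ℚ :* x)
                ≡.refl (fromℤ c) (seq x n) (seq y n))) h′
        where open +-*-Solver

      smallₚ-P^-+ : ∀ e f x → ∣ ιₚ (P^ e) *ₚ x ∣ₚ≤p^- 0 → ∣ ιₚ (P^ (f ℕ.+ e)) *ₚ x ∣ₚ≤p^- 0
      smallₚ-P^-+ e f x h = smallₚ-resp {ιₚ (P^ f) *ₚ (ιₚ (P^ e) *ₚ x)} {ιₚ (P^ (f ℕ.+ e)) *ₚ x} {0}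
        (pointwise {ιₚ (P^ f) *ₚ (ιₚ (P^ e) *ₚ x)} {ιₚ (P^ (f ℕ.+ e)) *ₚ x} (λ n →
          ≡.trans (≡.sym (ℚ.*-assoc (fromℤ (P^ f)) (fromℤ (P^ e)) (seq x n)))
            (cong (ℚ._* seq x n) (≡.trans (≡.sym (fromℤ-homo-* (P^ f) (P^ e)))
              (cong fromℤ (≡.sym (RationalAdic.P^-+ p p-prime f e)))))))
        (smallₚ-* {ιₚ (P^ f)} {ιₚ (P^ e) *ₚ x} {0} {0} (smallₚ-ι₀ (P^ f)) h)

      W-bounded : ∀ z → ∃ λ e → W 0 (ι r (P^ e) * z)
      W-bounded (x , y) =
        let e , hx = smallₚ-bounded x
            f , hy = smallₚ-bounded y
        in e ℕ.+ f , unscale (P^ (e ℕ.+ f)) x y 0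
             (≡.subst (λ g → ∣ ιₚ (P^ g) *ₚ x ∣ₚ≤p^- 0) (ℕ.+-comm f e) (smallₚ-P^-+ e f x hx))
             (smallₚ-P^-+ f e y hy)

      -- p ∣ x² + Dy² and p ∣ 2xy give p ∣ x² (x² + Dy²) − D (xy)² = x⁴, so p ∣ x, and then p ∣ Dy².
      W-sqrt : ¬ P ∣ + 2 → ∀ z → W 0 z → W 1 (z * z) → W 1 z
      W-sqrt P∤2 (x , y) (hx , hy) (h , h′) = x∈p , y∈p
        where
        open +-*-Solver
        xy∈p : ∣ x *ₚ y ∣ₚ≤p^- 1
        xy∈p = smallₚ-cancel-unit {x *ₚ y} {1} (+ 2) P∤2
          (smallₚ-resp {x *ₚ y +ₚ y *ₚ x} {ιₚ (+ 2) *ₚ (x *ₚ y)} {1}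
            (pointwise {x *ₚ y +ₚ y *ₚ x} {ιₚ (+ 2) *ₚ (x *ₚ y)}
              (λ n → solve 2 (λ x y → x :* y :+ y :* x := con (fromℤ (+ 2)) :* (x :* y))
                ≡.refl (seq x n) (seq y n))) h′)
        x⁴ s₁ s₂ s₃ : ℚₚ
        x⁴ = (x *ₚ x) *ₚ (x *ₚ x)
        s₁ = (x *ₚ x) *ₚ (x *ₚ x +ₚ Δ *ₚ (y *ₚ y))
        s₂ = (Δ *ₚ (x *ₚ y)) *ₚ (x *ₚ y)
        s₃ = x *ₚ x +ₚ Δ *ₚ (y *ₚ y)
        x∈p : ∣ x ∣ₚ≤p^- 1
        x∈p = smallₚ-sqrt {x} (smallₚ-sqrt {x *ₚ x}
          (smallₚ-resp {s₁ +ₚ -ₚ s₂} {x⁴} {1}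
            (pointwise {s₁ +ₚ -ₚ s₂} {x⁴}
              (λ n → solve 3 (λ x y d → (x :* x) :* (x :* x :+ d :* (y :* y))
                                         :+ :- ((d :* (x :* y)) :* (x :* y))
                                       := (x :* x) :* (x :* x)) ≡.refl (seq x n) (seq y n) (fromℤ D)))
            (smallₚ-+ {s₁} { -ₚ s₂} {1}
              (smallₚ-* {x *ₚ x} {x *ₚ x +ₚ Δ *ₚ (y *ₚ y)} {0} {1} (smallₚ-* {x} {x} {0} {0} hx hx) h)
              (smallₚ-neg {s₂} {1} (smallₚ-* {Δ *ₚ (x *ₚ y)} {x *ₚ y} {0} {1}
                (smallₚ-* {Δ} {x *ₚ y} {0} {0} (smallₚ-ι₀ D) (smallₚ-* {x} {y} {0} {0} hx hy)) xy∈p)))))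
        y∈p : ∣ y ∣ₚ≤p^- 1
        y∈p = smallₚ-sqrt {y} (smallₚ-cancel-unit {y *ₚ y} {1} D P∤D
          (smallₚ-resp {s₃ +ₚ -ₚ (x *ₚ x)} {Δ *ₚ (y *ₚ y)} {1}
            (pointwise {s₃ +ₚ -ₚ (x *ₚ x)} {Δ *ₚ (y *ₚ y)}
              (λ n → solve 3 (λ x y d → (x :* x :+ d :* (y :* y)) :+ :- (x :* x) := d :* (y :* y))
                ≡.refl (seq x n) (seq y n) (fromℤ D)))
            (smallₚ-+ {s₃} { -ₚ (x *ₚ x)} {1} h
              (smallₚ-neg {x *ₚ x} {1} (smallₚ-* {x} {x} {0} {1} hx x∈p)))))

    outsideLattice : ¬ P ∣ + 2 → Lattice r
    outsideLattice P∤2 = record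
      { V = W
      ; V-resp = λ {k} {(x , y)} {(x′ , y′)} (e , e′) (h , h′) →
          smallₚ-resp {x} {x′} {k} e h , smallₚ-resp {y} {y′} {k} e′ h′
      ; V-+ = λ {k} {(x , y)} {(x′ , y′)} (h , h′) (g , g′) →
          smallₚ-+ {x} {x′} {k} h g , smallₚ-+ {y} {y′} {k} h′ g′
      ; V-* = λ {j} {k} {x} {y} → W-* {j} {k} x y
      ; V-embed = λ {k} h → h , smallₚ-ι {k} (divides 0ℤ ≡.refl)
      ; V-cancel = λ {k} {(x , y)} h →
          let hx , hy = scale P x y (suc k) h
          in smallₚ-cancel-P {x} {k} hx , smallₚ-cancel-P {y} {k} hy
      ; V-bounded = W-bounded
      ; V-sqrt = λ {z} → W-sqrt P∤2 z
      ; 1∉V₁ = λ (h , _) → 1-not-smallₚ h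
      ; V⇒Integral = λ {z} → outside-integral z }

  -- The lattice is ℤₚ or ℤₚ[√D]. If p divided D, √D would be nilpotent modulo p in the latter and
  -- `V-sqrt` would fail.
  lattice : ∀ {D} → ¬ P ∣ + 2 → ¬ P ∣ D → (r : SquareRoot D) → Lattice r
  lattice P∤2 P∤D (inside s s²)  = insideLattice s s²
  lattice P∤2 P∤D (outside D≢□) = Outside.outsideLattice P∤D D≢□ P∤2

module IntegersOfLattice (p : ℕ) (p-prime : Prime p) {D : ℤ} (r : Adic.SquareRoot p p-prime D)
  (lat : Lattices.Lattice p p-prime r) where
  open Signed
  open PrimePowers p p-prime
  open Adic p p-prime
  open SmallAdics p p-prime
  open EmbeddingIsHomomorphism p p-prime
  open Lattices p p-prime
  open Lattice lat
  open CommutativeRing (ℚₚ⟨√⟩ r)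
  open QuadraticField r using (_^_; monic; Integral)
  open IntegerCoefficients (ℚₚ⟨√⟩ r)
  open IsHomomorphism (ι-homo r)
  open Solver (ι-homo r)

  V-ι : ∀ {k z} → P^ k ∣ z → V k (ι r z)
  V-ι h = V-embed (smallₚ-ι h)

  V-ι₀ : ∀ z → V 0 (ι r z)
  V-ι₀ z = V-embed (smallₚ-ι₀ z)

  V-1# : V 0 1#
  V-1# = V-resp 1-homo (V-ι₀ 1ℤ)

  V-neg : ∀ {k x} → V k x → V k (- x)
  V-neg {k} {x} h = V-resp (solve 1 (λ x → con (ℤ.- 1ℤ) :* x := :- x) refl x)
    (V-* {0} {k} (V-ι₀ (ℤ.- 1ℤ)) h)

  V-^ : ∀ {x} n → V 0 x → V 0 (x ^ n)
  V-^ zero    h = V-1#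
  V-^ (suc n) h = V-* {0} {0} h (V-^ n h)

  -- O / p O is reduced.
  V-root : ∀ {x} → V 0 x → ∀ n → V 1 (x ^ suc n) → V 1 x
  V-root {x} hx zero    h = V-resp (*-identityʳ x) h
  -- The exponent drops by one: the square of xⁿ⁺¹ is xⁿ⁺² xⁿ, which lies in p O.
  V-root {x} hx (suc n) h = V-root hx n (V-sqrt (V-^ (suc n) hx)
    (V-resp (solve 2 (λ x X → x :* (x :* X) :* X := x :* X :* (x :* X)) refl x (x ^ n))
      (V-* {1} {0} h (V-^ n hx))))

  -- For f monic of degree n, qⁿ f(z) is (q z)ⁿ plus the terms cᵢ qⁿ⁻ⁱ (q z)ⁱ with i < n, each of
  -- which contains a factor q from p O.
  monic-scaled : ∀ q z → V 0 q → V 1 q → V 0 (q * z) → ∀ cs → All (λ c → ∣ c ∣ₚ≤p^- 0) cs →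
                 V 1 (q ^ length cs * monic cs z - (q * z) ^ length cs)
  monic-scaled q z q₀ q₁ qz [] [] = V-resp
    (trans 0-homo (sym (trans (+-congʳ (*-identityˡ 1#)) (-‿inverseʳ 1#)))) (V-ι (divides 0ℤ ≡.refl))
  monic-scaled q z q₀ q₁ qz (c ∷ cs) (hc ∷ hcs) = V-resp
    (solve 6 (λ q z Q C M Y → q :* (Q :* C) :+ q :* z :* (Q :* M :- Y)
                            := q :* Q :* (C :+ z :* M) :- q :* z :* Y)
      refl q z (q ^ length cs) (embed r c) (monic cs z) ((q * z) ^ length cs))
    (V-+ (V-* {1} {0} q₁ (V-* {0} {0} (V-^ (length cs) q₀) (V-embed hc)))
         (V-* {0} {1} qz (monic-scaled q z q₀ q₁ qz cs hcs)))

  scaled-V₁ : ∀ q z → V 0 q → V 1 q → V 0 (q * z) → Integral z → V 1 (q * z)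
  scaled-V₁ q z q₀ q₁ qz (cs , hcs , root) =
    conclude cs (V-resp rearrange (V-neg (monic-scaled q z q₀ q₁ qz cs hcs)))
    where
    open import Relation.Binary.Reasoning.Setoid setoid
    rearrange : - (q ^ length cs * monic cs z - (q * z) ^ length cs) ≈ (q * z) ^ length cs
    rearrange = begin
      - (q ^ length cs * monic cs z - (q * z) ^ length cs)
        ≈⟨ -‿cong (+-congʳ (*-congˡ (trans root (sym 0-homo)))) ⟩
      - (q ^ length cs * ι r 0ℤ - (q * z) ^ length cs)
        ≈⟨ solve 2 (λ Q Y → :- (Q :* con 0ℤ :- Y) := Y) refl (q ^ length cs) ((q * z) ^ length cs) ⟩
      (q * z) ^ length cs ∎
    conclude : ∀ (cs : List ℚₚ) → V 1 ((q * z) ^ length cs) → V 1 (q * z)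
    -- In degree 0 the integral equation would read 1 = 0.
    conclude []       h = ⊥-elim (1∉V₁ h)
    conclude (_ ∷ cs) h = V-root qz (length cs) h

  -- Some p^e z lies in O. As long as e > 0, the integral equation puts a power of p^e z into p O; O
  -- / p O being reduced, p^e z itself is there, and one factor p cancels.
  Integral⇒V : ∀ {z} → Integral z → V 0 z
  Integral⇒V {z} iz = let e , h = V-bounded z in descend e h
    where
    descend : ∀ e → V 0 (ι r (P^ e) * z) → V 0 z
    descend zero    h = V-resp (trans (*-congʳ 1-homo) (*-identityˡ z)) h
    descend (suc e) h = descend e (V-cancel {0} {ι r (P^ e) * z} (V-resp
      (trans (*-congʳ (trans (reflexive (cong (ι r) (P^-suc e))) (*-homo P (P^ e))))
        (*-assoc (ι r P) (ι r (P^ e)) z))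
      (scaled-V₁ (ι r (P^ suc e)) z (V-ι₀ (P^ suc e)) (V-ι P^1∣) h iz)))
      where
      P^1∣ : P^ 1 ∣ P^ suc e
      P^1∣ = divides (P^ e) (≡.trans (P^-suc e)
        (≡.trans (ℤ.*-comm P (P^ e)) (cong (P^ e ℤ.*_) (≡.sym P^1))))

-- The order of λ₂/λ₁ modulo a uniformizer

module UnramifiedOrder (p : ℕ) (p-prime : Prime p) (3≤p : 3 ≤ p) (a : ℤ)
  (P∤D : ¬ + p Signed.∣ a ℤ.* a ℤ.+ + 4) (r : Adic.SquareRoot p p-prime (a ℤ.* a ℤ.+ + 4)) where
  open Signed
  open PrimePowers p p-prime
  open OddPrime p p-prime 3≤p
  open Adic p p-prime
  open RationalAdic p p-prime
  open SmallAdics p p-prime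
  open EmbeddingIsHomomorphism p p-prime
  open Lattices p p-prime
  private
    D = a ℤ.* a ℤ.+ + 4
    lat : Lattice r
    lat = lattice ∤2 P∤D r
  open Lattice lat
  open IntegersOfLattice p p-prime r lat
  open CommutativeRing (ℚₚ⟨√⟩ r)
  open QuadraticField r using (_^_; Integral; _∣ₒ_; NotDivisibleAtOrder)
  open IntegerCoefficients (ℚₚ⟨√⟩ r)
  open IsHomomorphism (ι-homo r)
  open Solver (ι-homo r)
  open Lucas a using (L)
  open Binet (ℚₚ⟨√⟩ r) (ι-homo r) a (√ r) (embed r (fromℚ ½)) (√-squared r) (2*½≈1 r)
  open import Relation.Binary.Reasoning.Setoid setoid

  private
    s = √ r

  -- Reading √D as a root of Z² - D treats both forms of `r` at once.
  V-√ : V 0 s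
  V-√ = Integral⇒V ((ιₚ (ℤ.- D) ∷ ιₚ 0ℤ ∷ []) , smallₚ-ι₀ (ℤ.- D) ∷ smallₚ-ι₀ 0ℤ ∷ [] , (begin
    ι r (ℤ.- D) + s * (ι r 0ℤ + s * 1#)
      ≈⟨ +-cong (trans (neg-homo D) (-‿cong (sym (√-squared r))))
           (*-congˡ (+-congˡ (*-congˡ (sym 1-homo)))) ⟩
    - (s * s) + s * (ι r 0ℤ + s * ι r 1ℤ)
      ≈⟨ solve 1 (λ s → :- (s :* s) :+ s :* (con 0ℤ :+ s :* con 1ℤ) := con 0ℤ) refl s ⟩
    ι r 0ℤ
      ≈⟨ 0-homo ⟩
    0# ∎))

  V-½ : V 0 (embed r (fromℚ ½))
  V-½ = V-embed (smallₚ-fromℚ (small-introℤ 1ℤ (+ 2) ∤2 ≡.refl))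

  V-λ₁ : V 0 λ₁
  V-λ₁ = V-* {0} {0} (V-+ (V-ι₀ a) V-√) V-½

  V-λ₂ : V 0 λ₂
  V-λ₂ = V-* {0} {0} (V-+ (V-ι₀ a) (V-neg V-√)) V-½

  p-integral : Integral (ι r P)
  p-integral = V⇒Integral (V-ι₀ P)

  p-nonunit : ¬ ι r P ∣ₒ 1#
  p-nonunit (w , iw , 1≈pw) = 1∉V₁ (V-resp (sym 1≈pw)
    (V-* {1} {0} (V-ι (∣-reflexive P^1)) (Integral⇒V iw)))

  P²∤Lα : ∀ α → IsRankOfAppearance L p α → NotDivisibleAtOrder a → ¬ P^ 2 ∣ L α
  P²∤Lα α (1≤α , P∣Lα , least)
    (π , u , l , ((_ , π∤1 , π-generates) , _) , uλ₁≈λ₂ , (1≤l , π∣uˡ-1 , l-least) , π²∤) P²∣Lα =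
    π²∤ (≡.subst (λ m → π ^ 2 ∣ₒ u ^ m - 1#) (≡.sym l≡α) π²∣)
    where
    w₀ : Carrier
    -- As an integral non-unit, p is a multiple π w₀, so each factor p of an integer yields a factor
    -- π.
    w₀ = proj₁ (π-generates (ι r P) p-integral p-nonunit)
    V-w₀ : V 0 w₀
    V-w₀ = Integral⇒V (proj₁ (proj₂ (π-generates (ι r P) p-integral p-nonunit)))
    p≈πw₀ : ι r P ≈ π * w₀
    p≈πw₀ = proj₂ (proj₂ (π-generates (ι r P) p-integral p-nonunit))

    t : Carrier
    t = - s * (- λ₂) ^ α
    V-t : V 0 t
    V-t = V-* {0} {0} (V-neg V-√) (V-^ α (V-neg V-λ₂))

    multiple-of-p : ∀ {x} → P ∣ x → ∃ λ w → V 0 w × ι r x ≈ π * w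
    multiple-of-p {x} (divides c x≡cP) = ι r c * w₀ , V-* {0} {0} (V-ι₀ c) V-w₀ , (begin
      ι r x                ≈⟨ trans (reflexive (cong (ι r) x≡cP)) (*-homo c P) ⟩
      ι r c * ι r P        ≈⟨ *-congˡ p≈πw₀ ⟩
      ι r c * (π * w₀)     ≈⟨ solve 3 (λ c π w → c :* (π :* w) := π :* (c :* w)) refl (ι r c) π w₀ ⟩
      π * (ι r c * w₀)     ∎)

    π∣ : π ∣ₒ u ^ α - 1#
    π∣ = let w , V-w , Lα≈ = multiple-of-p (∣ᵤ⇒∣ {P} {L α} P∣Lα)
         in w * t , V⇒Integral (V-* {0} {0} V-w V-t) , (begin
      u ^ α - 1#       ≈⟨ quotient-power u uλ₁≈λ₂ α ⟩
      ι r (L α) * t    ≈⟨ *-congʳ Lα≈ ⟩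
      π * w * t        ≈⟨ *-assoc π w t ⟩
      π * (w * t)      ∎)

    π²∣ : π ^ 2 ∣ₒ u ^ α - 1#
    π²∣ = let c = quotient P²∣Lα
              Lα≡ = ≡.trans (_∣_.equality P²∣Lα) (cong (c ℤ.*_) P^2)
          in ι r c * (w₀ * w₀) * t
           , V⇒Integral (V-* {0} {0} (V-* {0} {0} (V-ι₀ c) (V-* {0} {0} V-w₀ V-w₀)) V-t)
           , (begin
      u ^ α - 1#                                ≈⟨ quotient-power u uλ₁≈λ₂ α ⟩
      ι r (L α) * t                             ≈⟨ *-congʳ (reflexive (cong (ι r) Lα≡)) ⟩
      ι r (c ℤ.* (P ℤ.* P)) * t                 ≈⟨ *-congʳ (trans (*-homo c _) (*-congˡ (*-homo P P))) ⟩
      ι r c * (ι r P * ι r P) * t               ≈⟨ *-congʳ (*-congˡ (*-cong p≈πw₀ p≈πw₀)) ⟩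
      ι r c * (π * w₀ * (π * w₀)) * t
        ≈⟨ solve 4 (λ c π w t → c :* (π :* w :* (π :* w)) :* t := π :* (π :* con 1ℤ) :* (c :* (w :* w) :* t))
             refl (ι r c) π w₀ t ⟩
      π * (π * ι r 1ℤ) * (ι r c * (w₀ * w₀) * t) ≈⟨ *-congʳ (*-congˡ (*-congˡ 1-homo)) ⟩
      π ^ 2 * (ι r c * (w₀ * w₀) * t)           ∎)

    -- Otherwise Lₗ D is invertible modulo p, while π divides both Lₗ D and p.
    P∣Ll : P ∣ L l
    P∣Ll = decidable-stable (P ∣? L l) λ P∤Ll →
      let i , p∣LDi-1 = inverse (L l ℤ.* D) (∤-* P∤Ll P∤D)
          v′ , V-v′ , LDi-1≈πv′ = multiple-of-p p∣LDi-1
      in π∤1 (v * ι r i - v′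
            , V⇒Integral (V-+ (V-* {0} {0} V-v (V-ι₀ i)) (V-neg V-v′))
            , unit i v′ LDi-1≈πv′)
      where
      w : Carrier
      w = proj₁ π∣uˡ-1
      v : Carrier
      v = w * (λ₁ ^ l * - s)
      V-v : V 0 v
      V-v = V-* {0} {0} (Integral⇒V (proj₁ (proj₂ π∣uˡ-1))) (V-* {0} {0} (V-^ l V-λ₁) (V-neg V-√))
      LD≈πv : ι r (L l ℤ.* D) ≈ π * v
      LD≈πv = begin
        ι r (L l ℤ.* D)                   ≈⟨ *-homo (L l) D ⟩
        ι r (L l) * ι r D                 ≈⟨ *-congˡ (√-squared r) ⟨
        ι r (L l) * (s * s)
          ≈⟨ solve 2 (λ F s → F :* (s :* s) := F :* :- s :* :- s)
               refl (ι r (L l)) s ⟩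
        ι r (L l) * - s * - s             ≈⟨ *-congʳ (quotient-power-* u uλ₁≈λ₂ l) ⟨
        (u ^ l - 1#) * λ₁ ^ l * - s       ≈⟨ *-congʳ (*-congʳ (proj₂ (proj₂ π∣uˡ-1))) ⟩
        π * w * λ₁ ^ l * - s
          ≈⟨ solve 4 (λ π w x s → π :* w :* x :* :- s := π :* (w :* (x :* :- s)))
               refl π w (λ₁ ^ l) s ⟩
        π * v                             ∎
      unit : ∀ i v′ → ι r (L l ℤ.* D ℤ.* i ℤ.- 1ℤ) ≈ π * v′ → 1# ≈ π * (v * ι r i - v′)
      unit i v′ LDi-1≈πv′ = begin
        1#
          ≈⟨ 1-homo ⟨
        ι r 1ℤ
          ≈⟨ solve 1 (λ x → con 1ℤ := x :- (x :- con 1ℤ)) refl (ι r (L l ℤ.* D) * ι r i) ⟩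
        ι r (L l ℤ.* D) * ι r i - (ι r (L l ℤ.* D) * ι r i - ι r 1ℤ)
          ≈⟨ +-congˡ (-‿cong (trans (+-cong (sym (*-homo (L l ℤ.* D) i)) (sym (neg-homo 1ℤ)))
               (sym (+-homo (L l ℤ.* D ℤ.* i) (ℤ.- 1ℤ))))) ⟩
        ι r (L l ℤ.* D) * ι r i - ι r (L l ℤ.* D ℤ.* i ℤ.- 1ℤ)
          ≈⟨ +-cong (*-congʳ LD≈πv) (-‿cong LDi-1≈πv′) ⟩
        π * v * ι r i - π * v′
          ≈⟨ solve 4 (λ π v i v′ → π :* v :* i :- π :* v′ := π :* (v :* i :- v′)) refl π v (ι r i) v′ ⟩
        π * (v * ι r i - v′) ∎

    l≡α : l ≡ α
    l≡α = ℕ.≤-antisym (l-least α 1≤α π∣) (least l 1≤l (∣⇒∣ᵤ P∣Ll))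

-- From the hypotheses to the simple zero and the covering

module _ (p : ℕ) (p-prime : Prime p) (3≤p : 3 ≤ p) (a : ℤ) where
  open PrimePowers p p-prime
  open Adic p p-prime
  open Lucas a using (L)

  simple-zero : ∀ α → IsRankOfAppearance L p α → 2 < α →
    P^ 2 Signed.∣ a ℤ.* a ℤ.+ + 4 ⊎
      (∃ λ (r : SquareRoot (a ℤ.* a ℤ.+ + 4)) → QuadraticField.NotDivisibleAtOrder r a) →
    ¬ P^ 2 Signed.∣ L α
  simple-zero α rank@(_ , _ , least) 2<α hypothesis with P Signed.∣? a ℤ.* a ℤ.+ + 4
  ... | yes P∣D = OddPrime.Ramified.P²∤Lα p p-prime 3≤p a P∤a P∣D α rank
    where
    L2≡a : a ≡ L 2
    L2≡a = ≡.sym (≡.trans (ℤ.+-identityʳ (a ℤ.* 1ℤ)) (ℤ.*-identityʳ a))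
    P∤a : ¬ P Signed.∣ a
    -- Since L₂ = a, a multiple of p here would make the rank of appearance at most 2.
    P∤a P∣a = ℕ.<⇒≱ 2<α (least 2 (s≤s z≤n)
      (Signed.∣⇒∣ᵤ {P} {L 2} (≡.subst (P Signed.∣_) L2≡a P∣a)))
  ... | no P∤D with hypothesis
  ...   | inj₁ P²∣D = ⊥-elim (P∤D (P^suc∣⇒P∣ 1 P²∣D))
  ...   | inj₂ (r , notDivisible) = UnramifiedOrder.P²∤Lα p p-prime 3≤p a P∤D r α rank notDivisible

  covering-of-simple-zero : ∀ γ → 1 ≤ γ → IsRankOfAppearance L p (2 ℕ.+ γ) →
    ¬ P^ 2 Signed.∣ L (2 ℕ.+ γ) →
    Closure (ShiftRatios L (2 ℕ.+ γ)) ∪ Closure (ShiftRatios L γ) ≐ U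
  covering-of-simple-zero γ 1≤γ (_ , P∣Lα , least) P²∤Lα =
    Density.covering p p-prime 3≤p a γ (Signed.∣ᵤ⇒∣ P∣Lα) P²∤Lα
      -- Minimality of the rank applies only to positive indices, as L₀ = 0; hence `1≤γ`.
      (λ P∣Lγ → ℕ.m+1+n≰m γ (≡.subst (_≤ γ) (ℕ.+-comm 2 γ) (least γ 1≤γ (Signed.∣⇒∣ᵤ P∣Lγ))))

open import Data.Integer.Base using (_+_; _*_)
open import Data.Integer.Divisibility using (_∣_)
open import Data.Nat.Base using (_∸_; _^_)

theorem5 :
  ((a : ℤ) → a ≢ 0ℤ →
   (p : ℕ) (p-prime : Prime p) → 3 ≤ p →
   (α : ℕ) → IsRankOfAppearance (lucas a 1ℤ) p α → 2 < α →
   let open Adic p p-prime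
       L = lucas a 1ℤ
       D = a * a + + 4
   in + (p ^ 2) ∣ D ⊎ (∃ λ (r : SquareRoot D) → QuadraticField.NotDivisibleAtOrder r a) →
      Closure (ShiftRatios L α) ∪ Closure (ShiftRatios L (α ∸ 2)) ≐ U)
  ×
  ((p : ℕ) (p-prime : Prime p) → 3 ≤ p → ¬ IsWallSunSun p →
   (α : ℕ) → IsRankOfAppearance fibonacci p α →
   let open Adic p p-prime
   in Closure (ShiftRatios fibonacci α) ∪ Closure (ShiftRatios fibonacci (α ∸ 2)) ≐ U)
theorem5 = lucas-case , fibonacci-case
  where
  lucas-case : _
  lucas-case a _ p p-prime 3≤p (suc (suc γ)) rank 2<α@(s≤s (s≤s 1≤γ)) hypothesis =
    covering-of-simple-zero p p-prime 3≤p a γ 1≤γ rank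
      (simple-zero p p-prime 3≤p a (suc (suc γ)) rank 2<α
        ([ (λ P²∣D → inj₁ (Signed.∣ᵤ⇒∣ P²∣D)) , inj₂ ]′ hypothesis))

  fibonacci-case : _
  fibonacci-case p p-prime 3≤p ¬wss = λ
    -- F₁ = F₂ = 1, so the rank of appearance is at least 3.
    { 1 (_ , p∣1 , _) → ⊥-elim (PrimePowers.∤1 p p-prime (Signed.∣ᵤ⇒∣ p∣1))
    ; 2 (_ , p∣1 , _) → ⊥-elim (PrimePowers.∤1 p p-prime (Signed.∣ᵤ⇒∣ p∣1))
    ; (suc (suc γ@(suc _))) rank → covering-of-simple-zero p p-prime 3≤p 1ℤ γ (s≤s z≤n) rank
        (λ P²∣Fα → ¬wss (p-prime , suc (suc γ) , rank , Signed.∣⇒∣ᵤ P²∣Fα)) }
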